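{- Let $G=(V\cup\{s\},E)$ be a finite, unoriented, connected, loop-free graph (multiple edges allowed) with distinguished sink vertex $s$, and let $e$ be an edge of $E$ which is neither a bridge (i.e. removing $e$ does not disconnect the graph) nor incident to the sink. Then \[L_G(x)=x\,L_{G\setminus e}(x)+L_{G.e}(x).\]
   Context: Graphs considered: finite, unoriented, connected, loop-free graphs $G=(V\cup\{s\},E)$, possibly with multiple edges, with a distinguished vertex $s$ called the sink. A configuration is $\eta=(\eta_v)_{v\in V}\in\mathbb{Z}_+^{|V|}$; it is stable if $\eta_v\le d^G(v)$ for all $v\in V$, where $d^G(v)$ is the degree of $v$ in $G$. In the stochastic sandpile model with parameter $p\in(0,1)$, grains are added at random vertices (with a distribution whose support is all of $V$), and an unstable vertex $x$ (with $\eta_x>d^G(x)$) topples by sending, independently along each incident edge, one grain to the neighbour with probability $p$ (grains sent to $s$ are lost); topplings continue until the configuration is stable. The stochastically recurrent configurations ${\sf Sto}(G)$ are the recurrent states of the resulting Markov chain on stable configurations (the recurrent class containing the maximal configuration $(d^G(v))_{v\in V}$). Equivalently, a stable $\eta$ is stochastically recurrent iff there is an orientation $O$ of the edges of $G$ such that for every $v\in V$, the number of edges oriented into $v$ is at least $1+d^G(v)-\eta_v$. The lacking polynomial is $L_G(x)=\sum_{\eta\in{\sf Sto}(G)}x^{\sum_{v\in V}(d^G(v)-\eta_v)}$. For an edge $e=\{x,y\}$ with $x,y\neq s$: $G\setminus e$ is $G$ with (one copy of) $e$ removed. $G.e$ is defined as follows: if $e$ is a simple edge, $G.e$ is $G$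 with $e$ contracted, i.e. $x$ and $y$ are replaced by a single vertex $x.y$ and all edges incident in $G$ to $x$ or $y$ (other than $e$) are now incident to $x.y$; if $e$ has multiplicity $k\ge 2$, one copy of $e$ is contracted in this way and the other $k-1$ copies are replaced by $k-1$ edges $\{x.y,s\}$ joining the merged vertex to the sink. -}

module Defs where

open import Data.Nat using (ℕ; zero; suc; _+_; _∸_; _>_)
open import Data.Fin using (Fin; zero; suc; punchOut; _≟_)
open import Data.Bool using (Bool; true; false; if_then_else_)
open import Data.List using (List; []; _∷_; length; map; removeAt)
open import Data.Vec using (Vec; lookup; replicate; tabulate; updateAt; _[_]≔_)
import Data.Vec as Vec
open import Data.Product using (_×_; _,_; Σ; ∃; ∃-syntax; proj₁; proj₂)
open import Data.Sum using (_⊎_)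
open import Data.Empty using (⊥)
open import Relation.Nullary using (¬_; yes; no; Dec)
open import Relation.Nullary.Decidable using (⌊_⌋; _×-dec_; _⊎-dec_)
open import Relation.Binary.PropositionalEquality using (_≡_; _≢_; refl)
open import Relation.Binary.Construct.Closure.ReflexiveTransitive using (Star)
open import Data.Refinement using (Refinement)
open import Data.List.Membership.Propositional using (_∈_)

-- Multigraphs with a sink.
-- A graph with n non-sink vertices has vertex set Fin (suc n);
-- the sink s is the vertex zero, and the non-sink vertex i : Fin n is
-- the vertex suc i.  Edges are an (unordered, i.e. each pair (a , b)
-- stands for the unoriented edge {a,b}) list, so multiple edges are
-- allowed (repeated entries).

Vertex : ℕ → Set
Vertex n = Fin (suc n)

sink : ∀ {n} → Vertex n
sink = zero

Edge : ℕ → Set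
Edge n = Vertex n × Vertex n

record Graph (n : ℕ) : Set where
  constructor graph
  field
    edges : List (Edge n)
open Graph public

LoopFree : ∀ {n} → Graph n → Set
LoopFree G = ∀ {a b} → (a , b) ∈ edges G → a ≢ b

data Adj {n} (G : Graph n) (u v : Vertex n) : Set where
  adj : (i : Fin (length (edges G))) →
        (Data.List.lookup (edges G) i ≡ (u , v)) ⊎ (Data.List.lookup (edges G) i ≡ (v , u)) →
        Adj G u v

Connected : ∀ {n} → Graph n → Set
Connected G = ∀ v → Star (Adj G) sink v

nbrs : ∀ {n} → List (Edge n) → Vertex n → List (Vertex n)
nbrs [] v = []
nbrs ((a , b) ∷ es) v with a ≟ v | b ≟ v
... | yes _ | _     = b ∷ nbrs es v
... | no _  | yes _ = a ∷ nbrs es v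
... | no _  | no _  = nbrs es v

deg : ∀ {n} → Graph n → Vertex n → ℕ
deg G v = length (nbrs (edges G) v)

delete : ∀ {n} (G : Graph n) → Fin (length (edges G)) → Graph n
delete G i = graph (removeAt (edges G) i)

-- merging vertex b into vertex a (both non-sink, a ≠ b); the merged
-- vertex a.b is the image of a.  The sink zero is sent to zero.
merge : ∀ {n} (a b : Vertex (suc n)) → Vertex (suc n) → Vertex n
merge a b v with b ≟ v
... | no b≢v = punchOut b≢v
... | yes _ with b ≟ a
...   | no b≢a = punchOut b≢a
...   | yes _  = zero  -- junk case (a ≡ b), excluded by the hypotheses

sameEdge : ∀ {n} → Edge n → Edge n → Bool
sameEdge (u , w) (a , b) = ⌊ ((u ≟ a) ×-dec (w ≟ b)) ⊎-dec ((u ≟ b) ×-dec (w ≟ a)) ⌋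

-- G.e : one copy of e = {a,b} is contracted; the other copies of e
-- become edges {a.b , s}; all other edges are relabelled.
contract : ∀ {n} (G : Graph (suc n)) → Fin (length (edges G)) → Graph n
contract G i with Data.List.lookup (edges G) i
... | (a , b) = graph (map f (removeAt (edges G) i))
  where
  f : Edge _ → Edge _
  f (u , w) = if sameEdge (u , w) (a , b)
                then (merge a b a , sink)
                else (merge a b u , merge a b w)

Config : ℕ → Set
Config n = Vec ℕ n

Stable : ∀ {n} → Graph n → Config n → Set
Stable G η = ∀ i → lookup η i Data.Nat.≤ deg G (suc i)

maxConfig : ∀ {n} → Graph n → Config n
maxConfig G = tabulate (λ i → deg G (suc i))

addGrain : ∀ {n} → Config n → Fin n → Config n
addGrain η i = updateAt η i suc

give : ∀ {n} → Config n → Vertex n → Config n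
give η zero    = η
give η (suc j) = addGrain η j

send : ∀ {n} → Config n → (vs : List (Vertex n)) → Vec Bool (length vs) → Config n
send η []       _              = η
send η (v ∷ vs) (true  Vec.∷ c) = give (send η vs c) v
send η (v ∷ vs) (false Vec.∷ c) = send η vs c

count : ∀ {m} → Vec Bool m → ℕ
count Vec.[]          = 0
count (true  Vec.∷ c) = suc (count c)
count (false Vec.∷ c) = count c

-- stochastic toppling of vertex suc i, c selects the edges along which
-- a grain is sent (each edge independently with probability p ∈ (0,1),
-- so every choice c has positive probability)
topple : ∀ {n} (G : Graph n) → Config n → (i : Fin n) →
         Vec Bool (deg G (suc i)) → Config n
topple G η i c = send (updateAt η i (λ k → k ∸ count c)) (nbrs (edges G) (suc i)) c

data ToppleStep {n} (G : Graph n) (η : Config n) : Config n → Set where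
  step : (i : Fin n) → lookup η i > deg G (suc i) →
         (c : Vec Bool (deg G (suc i))) → ToppleStep G η (topple G η i c)

Stabilises : ∀ {n} → Graph n → Config n → Config n → Set
Stabilises G η η' = Star (ToppleStep G) η η' × Stable G η'

-- positive-probability transition of the Markov chain on stable
-- configurations: add a grain at some vertex (every vertex has positive
-- probability), then stabilise
Transition : ∀ {n} → Graph n → Config n → Config n → Set
Transition G η η' = Stable G η × ∃[ i ] Stabilises G (addGrain η i) η'

-- stochastically recurrent configurations: the recurrent class of the
-- chain containing the maximal configuration
Sto : ∀ {n} → Graph n → Config n → Set
Sto G η = Star (Transition G) (maxConfig G) η × Star (Transition G) η (maxConfig G)

sumV : ∀ {m} → Vec ℕ m → ℕ
sumV = Vec.foldr _ _+_ 0

lack : ∀ {n} → Graph n → Config n → ℕ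
lack G η = sumV (tabulate (λ i → deg G (suc i) ∸ lookup η i))

-- The lacking polynomial L_G(x) = Σ_k |StoLack G k| x^k, represented by
-- its coefficient sets.

StoLack : ∀ {n} → Graph n → ℕ → Set
StoLack {n} G k = Refinement (Config n) (λ η → Sto G η × lack G η ≡ k)

xStoLack : ∀ {n} → Graph n → ℕ → Set
xStoLack G zero    = Refinement ⊥ (λ _ → ⊥)
xStoLack G (suc k) = StoLack G k

{-# OPTIONS --safe #-}
module Submission where

-- Subtracting from the degrees turns recurrent configurations into lacking vectors ℓ, and
-- ℓ is recurrent iff some orientation gives each vertex i ≠ s indegree > ℓ i.  An orientation
-- witnesses recurrence as follows: starting from the maximal configuration, the vertices are
-- processed so that each has a later neighbour; a processed vertex emits a grain along all its
-- edges except those directed to a processed vertex, and surplus grains escape to the sink.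
-- For an edge e = {x , y}, the lacking vectors of G that agree off x and y and share the value
-- of ℓ x + ℓ y correspond to a single lacking vector of G.e.  By an exchange argument, every
-- one of them except the one with least ℓ y arises by adding 1 at y to a lacking vector of
-- G ∖ e, and the least one does not.

open import Defs
open import Data.Nat using (ℕ; zero; suc; pred; _+_; _∸_; _≤_; _<_; z≤n; s≤s; _≤?_; _<?_; >-nonZero)
open import Data.Fin using (Fin; zero; suc; _≟_; punchIn; punchOut)
open import Data.List using (List; []; _∷_; length; lookup; map; removeAt; allFin)
open import Data.Product using (_×_; _,_; ∃; ∃-syntax; proj₁; proj₂)
open import Data.Sum using (_⊎_; inj₁; inj₂)
open import Relation.Binary.PropositionalEquality using (_≡_; _≢_; refl; sym; trans; cong; cong₂; subst; subst₂; module ≡-Reasoning)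
open import Function.Bundles using (_↔_; mk↔ₛ′)
open import Data.Bool as Bool using (Bool; true; false; not; if_then_else_)
open import Data.Empty using (⊥; ⊥-elim-irr)
open import Data.Fin.Properties using (punchInᵢ≢i; punchIn-injective; punchOut-punchIn; punchIn-punchOut; punchOut-cong; all?; suc-injective)
open import Data.Irrelevant as Irrelevant using ([_])
import Data.List.Membership.DecPropositional as DecMembership
open import Data.List.Membership.Propositional using (_∈_; _∉_)
open import Data.List.Membership.Propositional.Properties using (∈-allFin; ∈-lookup; ∈-map⁺)
open import Data.List.Properties using (map-cong)
open import Data.List.Relation.Unary.All as All using (All; []; _∷_)
open import Data.List.Relation.Unary.Any using (here; there; index)
open import Data.List.Relation.Unary.Any.Properties using (lookup-index)
open import Data.Nat.Properties as ℕₚ hiding (_≟_; suc-injective)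
open import Data.Nat.Tactic.RingSolver using (solve-∀)
open import Data.Refinement using (Refinement; _,_; value)
open import Data.Sum.Function.Propositional using (_⊎-↔_)
import Data.Sum.Properties as Sumₚ
open import Data.Vec as Vec using (Vec; []; _∷_; insertAt; updateAt; _[_]≔_)
open import Data.Vec.Properties as Vecₚ using (insertAt-lookup; insertAt-punchIn; lookup∘updateAt; lookup∘updateAt′; lookup∘update; lookup∘update′; lookup∘tabulate; tabulate∘lookup; tabulate-cong; insertAt-removeAt; removeAt-insertAt)
open import Function using (_∘_)
open import Function.Properties.Inverse using (↔-trans; ↔-sym)
open import Relation.Binary.Construct.Closure.ReflexiveTransitive using (Star; ε; _◅_; _◅◅_; gmap)
open import Relation.Binary.Definitions using (DecidableEquality)
open import Relation.Nullary using (¬_; Dec; yes; no; does; contradiction)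
open import Relation.Nullary.Decidable using (map′; _⊎-dec_; _×-dec_; dec-true; dec-false; recompute; isYes)
open import Relation.Unary using (Decidable)

-- Orientations and the exchange property

-- Degrees change under deletion and contraction, whereas the bound ℓ i < indegree does not mention
-- them; this is why the bijection is built on lacking vectors. A lacking vector usually has many
-- witnessing orientations, and the coefficient sets keep their membership proofs irrelevant, so the
-- maps may not depend on a witness: feasibility is decided by trying all orientations, and the
-- least ℓ y is found by a bounded search. The exchange argument is needed because two lacking
-- vectors with the same merged image can come with unrelated orientations. If e supports x in the
-- first, removing e may leave x one short; the second, which lacks more at x, shows that x can be
-- raised without breaking any other bound, save for one unit that may be taken from y.

δ : ∀ {m} → Fin m → Fin m → ℕ
δ u v = if does (u ≟ v) then 1 else 0

δ-refl : ∀ {m} (u : Fin m) → δ u u ≡ 1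
δ-refl u rewrite dec-true (u ≟ u) refl = refl

δ-≢ : ∀ {m} {u v : Fin m} → u ≢ v → δ u v ≡ 0
δ-≢ {u = u} {v} u≢v rewrite dec-false (u ≟ v) u≢v = refl

δ≤1 : ∀ {m} (u v : Fin m) → δ u v ≤ 1
δ≤1 u v with does (u ≟ v)
... | true  = s≤s z≤n
... | false = z≤n

hd tl : ∀ {n} → Bool → Edge n → Vertex n
hd true  (a , b) = b
hd false (a , b) = a
tl p = hd (not p)

Orientation : ∀ {n} → List (Edge n) → Set
Orientation es = Vec Bool (length es)

indeg : ∀ {n} (es : List (Edge n)) → Orientation es → Vertex n → ℕ
indeg []       []      v = 0
indeg (x ∷ es) (p ∷ o) v = δ (hd p x) v + indeg es o v

dist : ∀ {m} → Vec Bool m → Vec Bool m → ℕ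
dist []          []          = 0
dist (true  ∷ o) (true  ∷ p) = dist o p
dist (false ∷ o) (false ∷ p) = dist o p
dist (true  ∷ o) (false ∷ p) = suc (dist o p)
dist (false ∷ o) (true  ∷ p) = suc (dist o p)

dist-∷ : ∀ {m} p {o o₁ o′ : Vec Bool m} q → suc (dist o₁ o′) ≡ dist o o′ →
         suc (dist (p ∷ o₁) (q ∷ o′)) ≡ dist (p ∷ o) (q ∷ o′)
dist-∷ true  true  eq = eq
dist-∷ true  false eq = cong suc eq
dist-∷ false true  eq = cong suc eq
dist-∷ false false eq = eq

dist-flip : ∀ {m} p q {o o′ : Vec Bool m} → p ≢ q →
            suc (dist (q ∷ o) (q ∷ o′)) ≡ dist (p ∷ o) (q ∷ o′)
dist-flip true  true  p≢q = contradiction refl p≢q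
dist-flip true  false p≢q = refl
dist-flip false true  p≢q = refl
dist-flip false false p≢q = contradiction refl p≢q

-- The equation is additive on both sides to avoid truncated subtraction, and it covers w = y, where
-- all indegrees agree.
record Shift {n} (es : List (Edge n)) (w y : Vertex n) (o o₁ : Orientation es) : Set where
  constructor shift
  field
    balance : ∀ u → indeg es o₁ u + δ w u ≡ δ y u + indeg es o u
open Shift

left-comm : ∀ h k l → h + (k + l) ≡ k + (h + l)
left-comm = solve-∀

swap-outer : ∀ i j k → i + j + k ≡ i + (k + j)
swap-outer = solve-∀

interchange : ∀ i j k l → i + j + (k + l) ≡ i + k + (j + l)
interchange = solve-∀

shift-∷ : ∀ {n} (es : List (Edge n)) {w y} {o o₁} x p →
          Shift es w y o o₁ → Shift (x ∷ es) w y (p ∷ o) (p ∷ o₁)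
shift-∷ es {w} {y} {o} {o₁} x p sh = shift λ t → let h = δ (hd p x) t in begin
  h + indeg es o₁ t + δ w t   ≡⟨ +-assoc h _ _ ⟩
  h + (indeg es o₁ t + δ w t) ≡⟨ cong (h +_) (balance sh t) ⟩
  h + (δ y t + indeg es o t)  ≡⟨ left-comm h (δ y t) _ ⟩
  δ y t + (h + indeg es o t)  ∎
  where
  open ≡-Reasoning

-- Some edge points at y in `o′` but not in `o`. Reversing it takes a unit from its other end and
-- brings `o` one step closer to `o′`, so the distance serves as termination measure for `exchange`.
flip : ∀ {n} (es : List (Edge n)) (o o′ : Orientation es) y → indeg es o y < indeg es o′ y →
       ∃[ u ] ∃[ o₁ ] Shift es u y o o₁ × suc (dist o₁ o′) ≡ dist o o′
flip [] [] [] y ()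
flip (x ∷ es) (p ∷ o) (q ∷ o′) y lt with p Bool.≟ q
flip (x ∷ es) (p ∷ o) (p ∷ o′) y lt | yes refl
  with u , o₁ , sh , d ← flip es o o′ y (+-cancelˡ-< (δ (hd p x) y) _ _ lt)
  = u , p ∷ o₁ , shift-∷ es x p sh , dist-∷ p p d
... | no p≢q with hd q x ≟ y
...   | yes refl = hd p x , q ∷ o , shift (λ t → swap-outer (δ (hd q x) t) (indeg es o t) (δ (hd p x) t)) , dist-flip p q p≢q
...   | no h≢y
  with u , o₁ , sh , d ← flip es o o′ y (≤-<-trans (m≤n+m _ _) lt)
  = u , p ∷ o₁ , shift-∷ es x p sh , dist-∷ p q d

shift-trans : ∀ {n} (es : List (Edge n)) {w u y : Vertex n} {o o₁ o₂ : Orientation es} →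
              Shift es u y o o₁ → Shift es w u o₁ o₂ → Shift es w y o o₂
shift-trans es {w} {u} {y} {o} {o₁} {o₂} s₁ s₂ = shift λ t → +-cancelˡ-≡ (δ u t) _ _ (begin
  δ u t + (indeg es o₂ t + δ w t) ≡⟨ cong (δ u t +_) (balance s₂ t) ⟩
  δ u t + (δ u t + indeg es o₁ t) ≡⟨ cong (δ u t +_) (+-comm (δ u t) _) ⟩
  δ u t + (indeg es o₁ t + δ u t) ≡⟨ cong (δ u t +_) (balance s₁ t) ⟩
  δ u t + (δ y t + indeg es o t)  ∎)
  where open ≡-Reasoning

shift-≥ : ∀ {n} (es : List (Edge n)) {w y : Vertex n} {o o₁ : Orientation es} →
          Shift es w y o o₁ → ∀ t → t ≢ w → δ y t + indeg es o t ≤ indeg es o₁ t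
shift-≥ es {o₁ = o₁} sh t t≢w = ≤-reflexive (trans (sym (balance sh t)) (trans (cong (indeg es o₁ t +_) (δ-≢ (λ eq → t≢w (sym eq)))) (+-identityʳ _)))

shift-source : ∀ {n} (es : List (Edge n)) {w y : Vertex n} {o o₁ : Orientation es} →
          Shift es w y o o₁ → w ≢ y → suc (indeg es o₁ w) ≡ indeg es o w
shift-source es {w} {y} {o} {o₁} sh w≢y = begin
  suc (indeg es o₁ w)     ≡⟨ +-comm 1 _ ⟩
  indeg es o₁ w + 1       ≡⟨ cong (indeg es o₁ w +_) (sym (δ-refl w)) ⟩
  indeg es o₁ w + δ w w   ≡⟨ balance sh w ⟩
  δ y w + indeg es o w    ≡⟨ cong (_+ indeg es o w) (δ-≢ (λ eq → w≢y (sym eq))) ⟩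
  indeg es o w            ∎
  where open ≡-Reasoning

-- The shortage passes from y to u unless u exceeded `o′` before the shift; the path is then
-- continued from u.
shift-pending : ∀ {n} (es : List (Edge n)) {u y} {o o₁ o′} → Shift es u y o o₁ →
                indeg es o y < indeg es o′ y → indeg es o u ≤ indeg es o′ u →
                indeg es o₁ u < indeg es o′ u
shift-pending es {u} {y} {o} {o₁} {o′} sh lt le with u ≟ y
... | no u≢y = subst (_≤ indeg es o′ u) (sym (shift-source es sh u≢y)) le
-- The case of a loop: no indegree has changed, and y is still short.
... | yes refl = subst (_< indeg es o′ u) (+-cancelˡ-≡ 1 _ _ (begin
    suc (indeg es o u)    ≡⟨ cong (_+ indeg es o u) (sym (δ-refl u)) ⟩
    δ u u + indeg es o u  ≡⟨ sym (balance sh u) ⟩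
    indeg es o₁ u + δ u u ≡⟨ cong (indeg es o₁ u +_) (δ-refl u) ⟩
    indeg es o₁ u + 1     ≡⟨ +-comm _ 1 ⟩
    suc (indeg es o₁ u)   ∎)) lt
  where open ≡-Reasoning

-- Only y can gain, and being short it cannot overtake `o′`. So reversals create no new excess, and
-- an excess found further along the path was there from the start.
shift-excess : ∀ {n} (es : List (Edge n)) {u y w} {o o₁ o′} → Shift es u y o o₁ →
               indeg es o y < indeg es o′ y → indeg es o′ w < indeg es o₁ w →
               indeg es o′ w < indeg es o w
shift-excess es {u} {y} {w} {o} {o₁} sh lt gt with w ≟ y
... | yes refl = contradiction (begin
    indeg es o₁ y         ≤⟨ m≤m+n _ (δ u y) ⟩
    indeg es o₁ y + δ u y ≡⟨ balance sh y ⟩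
    δ y y + indeg es o y  ≡⟨ cong (_+ indeg es o y) (δ-refl y) ⟩
    suc (indeg es o y)    ≤⟨ lt ⟩
    _                     ∎) (<⇒≱ gt)
  where open ≤-Reasoning
... | no w≢y = <-≤-trans gt (begin
    indeg es o₁ w         ≤⟨ m≤m+n _ (δ u w) ⟩
    indeg es o₁ w + δ u w ≡⟨ balance sh w ⟩
    δ y w + indeg es o w  ≡⟨ cong (_+ indeg es o w) (δ-≢ (λ eq → w≢y (sym eq))) ⟩
    indeg es o w          ∎)
  where open ≤-Reasoning

-- Reversing edges of o along a path of edges on which o and o′ disagree raises
-- the indegree of y; the path can be stopped at a vertex where o exceeds o′.
exchange : ∀ {n} (es : List (Edge n)) (o o′ : Orientation es) y → indeg es o y < indeg es o′ y →
           ∃[ w ] ∃[ o₁ ] Shift es w y o o₁ × indeg es o′ w < indeg es o w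
exchange es o o′ y lt = go (dist o o′) o y refl lt
  where
  go : ∀ d o y → dist o o′ ≡ d → indeg es o y < indeg es o′ y →
       ∃[ w ] ∃[ o₁ ] Shift es w y o o₁ × indeg es o′ w < indeg es o w
  go d o y d≡ lt with flip es o o′ y lt
  go zero    o y d≡ lt | u , o₁ , sh , d = contradiction (trans d d≡) λ ()
  go (suc d) o y d≡ lt | u , o₁ , sh , d′ with indeg es o′ u <? indeg es o u
  ... | yes gt = u , o₁ , sh , gt
  ... | no ngt with w , o₂ , sh₂ , gt ← go d o₁ u (ℕₚ.suc-injective (trans d′ d≡)) (shift-pending es sh lt (≮⇒≥ ngt))
      = w , o₂ , shift-trans es sh sh₂ , shift-excess es sh lt gt

-- Lacking vectors under deletion of an edge

anyBits? : ∀ {m} {P : Vec Bool m → Set} → Decidable P → Dec (∃ P)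
anyBits? {zero}  P? = map′ ([] ,_) (λ { ([] , p) → p }) (P? [])
anyBits? {suc m} P? = map′
  (λ { (inj₁ (o , p)) → true ∷ o , p ; (inj₂ (o , p)) → false ∷ o , p })
  (λ { (true ∷ o , p) → inj₁ (o , p) ; (false ∷ o , p) → inj₂ (o , p) })
  (anyBits? (P? ∘ (true ∷_)) ⊎-dec anyBits? (P? ∘ (false ∷_)))

-- The lacking vectors of the recurrent configurations.
Feasible : ∀ {n} → List (Edge n) → Vec ℕ n → Set
Feasible es ℓ = ∃[ o ] ∀ i → Vec.lookup ℓ i < indeg es o (suc i)

feasible? : ∀ {n} (es : List (Edge n)) → Decidable (Feasible es)
feasible? es ℓ = anyBits? λ o → all? λ i → Vec.lookup ℓ i <? indeg es o (suc i)

insertBit : ∀ {n} (es : List (Edge n)) e p (o : Orientation (removeAt es e)) →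
            ∃[ o′ ] ∀ v → indeg es o′ v ≡ δ (hd p (lookup es e)) v + indeg (removeAt es e) o v
insertBit (x ∷ es) zero    p o = p ∷ o , λ v → refl
insertBit (x ∷ es) (suc e) p (q ∷ o) with o′ , eq ← insertBit es e p o
  = q ∷ o′ , λ v → trans (cong (δ (hd q x) v +_) (eq v)) (left-comm (δ (hd q x) v) (δ (hd p (lookup es e)) v) _)

removeBit : ∀ {n} (es : List (Edge n)) e (o : Orientation es) →
            ∃[ p ] ∃[ o′ ] ∀ v → indeg es o v ≡ δ (hd p (lookup es e)) v + indeg (removeAt es e) o′ v
removeBit (x ∷ es) zero    (p ∷ o) = p , o , λ v → refl
removeBit (x ∷ es) (suc e) (q ∷ o) with p , o′ , eq ← removeBit es e o
  = p , q ∷ o′ , λ v → trans (cong (δ (hd q x) v +_) (eq v)) (left-comm (δ (hd q x) v) (δ (hd p (lookup es e)) v) _)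

-- The bound N is returned untested when nothing below it satisfies P, so the result is meaningful
-- only if some value up to N does.
least : ∀ {P : ℕ → Set} → Decidable P → ℕ → ℕ
least P? zero    = zero
least P? (suc N) with P? 0
... | yes _ = zero
... | no  _ = suc (least (P? ∘ suc) N)

least-satisfies : ∀ {P : ℕ → Set} (P? : Decidable P) {N i} → i ≤ N → P i → P (least P? N)
least-satisfies P? {zero}  z≤n Pi = Pi
least-satisfies P? {suc N} i≤N Pi with P? 0
... | yes P0 = P0
least-satisfies P? {suc N} {zero}  i≤N       Pi | no ¬P0 = contradiction Pi ¬P0
least-satisfies P? {suc N} {suc i} (s≤s i≤N) Pi | no ¬P0 = least-satisfies (P? ∘ suc) i≤N Pi

least-≤ : ∀ {P : ℕ → Set} (P? : Decidable P) {N i} → i ≤ N → P i → least P? N ≤ i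
least-≤ P? {zero}  i≤N Pi = z≤n
least-≤ P? {suc N} i≤N Pi with P? 0
... | yes P0 = z≤n
least-≤ P? {suc N} {zero}  i≤N       Pi | no ¬P0 = contradiction Pi ¬P0
least-≤ P? {suc N} {suc i} (s≤s i≤N) Pi | no ¬P0 = s≤s (least-≤ (P? ∘ suc) i≤N Pi)

lookup-ext : ∀ {A : Set} {n} {xs ys : Vec A n} → (∀ i → Vec.lookup xs i ≡ Vec.lookup ys i) → xs ≡ ys
lookup-ext {xs = xs} {ys} eq = trans (sym (tabulate∘lookup xs)) (trans (tabulate-cong eq) (tabulate∘lookup ys))

sum-updateAt : ∀ {n} (xs : Vec ℕ n) i f → sumV (updateAt xs i f) + Vec.lookup xs i ≡ f (Vec.lookup xs i) + sumV xs
sum-updateAt (x ∷ xs) zero    f = swap-outer (f x) (sumV xs) x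
sum-updateAt (x ∷ xs) (suc i) f = trans (+-assoc x _ _) (trans (cong (x +_) (sum-updateAt xs i f)) (left-comm x (f (Vec.lookup xs i)) _))

sum-insertAt : ∀ {n} (xs : Vec ℕ n) i v → sumV (insertAt xs i v) ≡ v + sumV xs
sum-insertAt xs       zero    v = refl
sum-insertAt (x ∷ xs) (suc i) v = trans (cong (x +_) (sum-insertAt xs i v)) (left-comm x v _)

data PunchView {n} (y : Fin (suc n)) : Fin (suc n) → Set where
  self  : PunchView y y
  other : ∀ t → PunchView y (punchIn y t)

punchView : ∀ {n} (y i : Fin (suc n)) → PunchView y i
punchView y i with y ≟ i
... | yes refl = self
... | no y≢i = subst (PunchView y) (punchIn-punchOut y≢i) (other (punchOut y≢i))

module _ {n} (es : List (Edge (suc n))) (e : Fin (length es)) {x y : Fin (suc n)}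
         (x≢y : x ≢ y) (e≡ : lookup es e ≡ (suc x , suc y)) where

  private
    es⁻ = removeAt es e

  removeBit-xy : (o : Orientation es) → ∃[ p ] ∃[ o′ ] ∀ v →
                 indeg es o v ≡ δ (hd p (suc x , suc y)) v + indeg es⁻ o′ v
  removeBit-xy o = subst (λ z → ∃[ p ] ∃[ o′ ] ∀ v → indeg es o v ≡ δ (hd p z) v + indeg es⁻ o′ v) e≡ (removeBit es e o)

  insertBit-xy : ∀ p (o : Orientation es⁻) → ∃[ o′ ] ∀ v →
                 indeg es o′ v ≡ δ (hd p (suc x , suc y)) v + indeg es⁻ o v
  insertBit-xy p o = subst (λ z → ∃[ o′ ] ∀ v → indeg es o′ v ≡ δ (hd p z) v + indeg es⁻ o v) e≡ (insertBit es e p o)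

  hd-other : ∀ p {t} → t ≢ x → t ≢ y → δ (hd p (suc x , suc y)) (suc t) ≡ 0
  hd-other true  t≢x t≢y = δ-≢ (λ eq → t≢y (sym (suc-injective eq)))
  hd-other false t≢x t≢y = δ-≢ (λ eq → t≢x (sym (suc-injective eq)))

  module _ {ℓ ℓ′ ℓ⁻ : Vec ℕ (suc n)}
    (x-gap : Vec.lookup ℓ x < Vec.lookup ℓ′ x)
    (agree : ∀ t → t ≢ x → t ≢ y → Vec.lookup ℓ t ≡ Vec.lookup ℓ′ t)
    (ℓ⁻-y : suc (Vec.lookup ℓ⁻ y) ≡ Vec.lookup ℓ y)
    (ℓ⁻-≢ : ∀ t → t ≢ y → Vec.lookup ℓ⁻ t ≡ Vec.lookup ℓ t) where

    private
      transfer : (o₁ : Orientation es⁻) →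
                 (∀ t → t ≢ y → Vec.lookup ℓ t < indeg es⁻ o₁ (suc t)) →
                 Vec.lookup ℓ y ≤ indeg es⁻ o₁ (suc y) → Feasible es⁻ ℓ⁻
      transfer o₁ off at = o₁ , λ t → bound t
        where
        bound : ∀ t → Vec.lookup ℓ⁻ t < indeg es⁻ o₁ (suc t)
        bound t with t ≟ y
        ... | yes refl = ≤-trans (≤-reflexive ℓ⁻-y) at
        ... | no t≢y   = subst (_< _) (sym (ℓ⁻-≢ t t≢y)) (off t t≢y)

      -- The case where e pointed at x in the witness for ℓ, so that its removal may leave x with
      -- exactly ℓ x. Then `o′` has more at x, because ℓ′ x is larger, and `exchange` supplies the
      -- missing unit.
      reroute : (o o′ : Orientation es⁻) →
                Vec.lookup ℓ y < indeg es⁻ o (suc y) →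
                Vec.lookup ℓ x ≤ indeg es⁻ o (suc x) →
                Vec.lookup ℓ′ x ≤ indeg es⁻ o′ (suc x) →
                (∀ t → t ≢ x → t ≢ y → Vec.lookup ℓ t < indeg es⁻ o (suc t)) →
                (∀ t → t ≢ x → t ≢ y → Vec.lookup ℓ t < indeg es⁻ o′ (suc t)) →
                Feasible es⁻ ℓ⁻
      reroute o o′ oy ox o′x ot o′t with Vec.lookup ℓ x <? indeg es⁻ o (suc x)
      ... | yes lt = transfer o off (<⇒≤ oy)
        where
        off : ∀ t → t ≢ y → Vec.lookup ℓ t < indeg es⁻ o (suc t)
        off t t≢y with t ≟ x
        ... | yes refl = lt
        ... | no t≢x = ot t t≢x t≢y
      ... | no nlt = go (exchange es⁻ o o′ (suc x) x-lt)
        where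
        x-lt : indeg es⁻ o (suc x) < indeg es⁻ o′ (suc x)
        x-lt = ≤-<-trans (≮⇒≥ nlt) (<-≤-trans x-gap o′x)

        go : ∃[ w ] ∃[ o₁ ] Shift es⁻ w (suc x) o o₁ × indeg es⁻ o′ w < indeg es⁻ o w → Feasible es⁻ ℓ⁻
        go (w , o₁ , sh , gt) = transfer o₁ off at
          where
          w≢x : w ≢ suc x
          w≢x refl = <-asym x-lt gt

          keep : ∀ t → suc t ≢ w → indeg es⁻ o (suc t) ≤ indeg es⁻ o₁ (suc t)
          keep t t≢w = ≤-trans (m≤n+m _ _) (shift-≥ es⁻ sh (suc t) t≢w)

          off : ∀ t → t ≢ y → Vec.lookup ℓ t < indeg es⁻ o₁ (suc t)
          off t t≢y with t ≟ x
          ... | yes refl = ≤-trans (s≤s ox) (≤-trans (≤-reflexive (cong (_+ indeg es⁻ o (suc x)) (sym (δ-refl (suc x))))) (shift-≥ es⁻ sh (suc x) (w≢x ∘ sym)))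
          ... | no t≢x with suc t ≟ w
          -- The unit came from t, but there `o` exceeded `o′`, and `o′` alone meets the bound.
          ...   | yes refl = <-≤-trans (o′t t t≢x t≢y) (≤-pred (subst (indeg es⁻ o′ (suc t) <_) (sym (shift-source es⁻ sh w≢x)) gt))
          ...   | no t≢w = <-≤-trans (ot t t≢x t≢y) (keep t t≢w)

          at : Vec.lookup ℓ y ≤ indeg es⁻ o₁ (suc y)
          at with suc y ≟ w
          -- If y is the donor, its strict bound becomes a weak one, which is all that the lowered
          -- entry requires.
          ... | yes refl = ≤-pred (subst (Vec.lookup ℓ y <_) (sym (shift-source es⁻ sh w≢x)) oy)
          ... | no y≢w = ≤-trans (<⇒≤ oy) (keep y y≢w)

    -- If e points at y in the witness for ℓ, deleting it costs exactly the unit by which ℓ⁻ is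
    -- smaller there. Otherwise e supports x, and the witness for ℓ′ is needed as well.
    descend-y : Feasible es ℓ → Feasible es ℓ′ → Feasible es⁻ ℓ⁻
    descend-y (o , ℓ<o) (o′ , ℓ′<o′) with removeBit-xy o | removeBit-xy o′
    ... | true , o₁ , eq | _ = transfer o₁
        (λ t t≢y → subst (Vec.lookup ℓ t <_) (trans (eq (suc t)) (cong (_+ indeg es⁻ o₁ (suc t)) (δ-≢ (λ q → t≢y (sym (suc-injective q)))))) (ℓ<o t))
        (≤-pred (≤-trans (ℓ<o y) (≤-trans (≤-reflexive (eq (suc y))) (+-monoˡ-≤ _ (δ≤1 (suc y) (suc y))))))
    ... | false , o₁ , eq | p , o₂ , eq₂ = reroute o₁ o₂
        (subst (Vec.lookup ℓ y <_) (trans (eq (suc y)) (cong (_+ indeg es⁻ o₁ (suc y)) (δ-≢ (λ q → x≢y (suc-injective q))))) (ℓ<o y))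
        (≤-pred (≤-trans (ℓ<o x) (≤-trans (≤-reflexive (eq (suc x))) (+-monoˡ-≤ _ (δ≤1 (suc x) (suc x))))))
        (≤-pred (≤-trans (ℓ′<o′ x) (≤-trans (≤-reflexive (eq₂ (suc x))) (+-monoˡ-≤ _ (δ≤1 (hd p (suc x , suc y)) (suc x))))))
        (λ t t≢x t≢y → subst (Vec.lookup ℓ t <_) (trans (eq (suc t)) (cong (_+ indeg es⁻ o₁ (suc t)) (hd-other false t≢x t≢y))) (ℓ<o t))
        (λ t t≢x t≢y → subst (_< indeg es⁻ o₂ (suc t)) (sym (agree t t≢x t≢y)) (subst (Vec.lookup ℓ′ t <_) (trans (eq₂ (suc t)) (cong (_+ indeg es⁻ o₂ (suc t)) (hd-other p t≢x t≢y))) (ℓ′<o′ t)))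

-- Lacking vectors under contraction of an edge

contractEdge : ∀ {n} → Edge (suc n) → Edge (suc n) → Edge n
contractEdge (a , b) (u , w) = if sameEdge (u , w) (a , b)
  then (merge a b a , sink) else (merge a b u , merge a b w)

contract-edges : ∀ {n} (G : Graph (suc n)) e →
  edges (contract G e) ≡ map (contractEdge (lookup (edges G) e)) (removeAt (edges G) e)
contract-edges G e with lookup (edges G) e
... | (a , b) = map-cong (λ _ → refl) (removeAt (edges G) e)

sameEdge-hd : ∀ {n} (x y : Edge n) → sameEdge x y ≡ true → ∀ p → hd p x ≡ proj₁ y ⊎ hd p x ≡ proj₂ y
sameEdge-hd (u , w) (a , b) eq p
  with ((u ≟ a) ×-dec (w ≟ b)) ⊎-dec ((u ≟ b) ×-dec (w ≟ a))
sameEdge-hd _ _ eq true  | yes (inj₁ (u≡a , w≡b)) = inj₂ w≡b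
sameEdge-hd _ _ eq false | yes (inj₁ (u≡a , w≡b)) = inj₁ u≡a
sameEdge-hd _ _ eq true  | yes (inj₂ (u≡b , w≡a)) = inj₁ w≡a
sameEdge-hd _ _ eq false | yes (inj₂ (u≡b , w≡a)) = inj₂ u≡b

merge-self : ∀ {n} {a b : Vertex (suc n)} (b≢a : b ≢ a) → merge a b b ≡ punchOut b≢a
merge-self {a = a} {b} b≢a with b ≟ b
... | no b≢b = contradiction refl b≢b
... | yes _ with b ≟ a
...   | no _ = punchOut-cong b refl
...   | yes b≡a = contradiction b≡a b≢a

merge-punchOut : ∀ {n} (a : Vertex (suc n)) {b v : Vertex (suc n)} (b≢v : b ≢ v) →
                 merge a b v ≡ punchOut b≢v
merge-punchOut a {b} {v} b≢v with b ≟ v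
... | no _ = punchOut-cong b refl
... | yes b≡v = contradiction b≡v b≢v

merge-sink : ∀ {n} (a : Vertex (suc n)) y → merge a (suc y) sink ≡ sink
merge-sink a y = merge-punchOut a {suc y} {zero} λ ()

merge-punchIn : ∀ {n} (a : Vertex (suc n)) y t → merge a (suc y) (suc (punchIn y t)) ≡ suc t
merge-punchIn a y t = trans
  (merge-punchOut a {suc y} (λ eq → punchInᵢ≢i y t (sym (suc-injective eq))))
  (cong suc (trans (punchOut-cong y refl) (punchOut-punchIn y)))

module Contraction {n} (y : Fin (suc n)) (z : Fin n) where

  -- Naming x through z builds in x ≠ y, and `suc z` is then the merged vertex.
  x : Fin (suc n)
  x = punchIn y z

  x≢y : x ≢ y
  x≢y = punchInᵢ≢i y z

  private
    a b : Vertex (suc n)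
    a = suc x
    b = suc y

  merge-b : merge a b b ≡ suc z
  merge-b = trans (merge-self b≢a) (trans (sym (merge-punchOut a b≢a)) (merge-punchIn a y z))
    where
    b≢a : b ≢ a
    b≢a eq = x≢y (sym (suc-injective eq))

  δ-punchIn : ∀ s t → δ {suc (suc n)} (suc (punchIn y s)) (suc (punchIn y t)) ≡ δ {suc n} (suc s) (suc t)
  δ-punchIn s t with s ≟ t
  ... | yes refl = δ-refl (suc (punchIn y s))
  ... | no s≢t   = δ-≢ λ eq → s≢t (punchIn-injective y s t (suc-injective eq))

  δ-merge-≢ : ∀ h t → t ≢ z → δ (merge a b h) (suc t) ≡ δ h (suc (punchIn y t))
  δ-merge-≢ zero t t≢z = cong (λ v → δ v (suc t)) (merge-sink a y)
  δ-merge-≢ (suc i) t t≢z with punchView y i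
  ... | self = trans (cong (λ v → δ v (suc t)) merge-b)
                 (trans (δ-≢ λ eq → t≢z (sym (suc-injective eq)))
                        (sym (δ-≢ {u = b} λ eq → punchInᵢ≢i y t (sym (suc-injective eq)))))
  ... | other s = trans (cong (λ v → δ v (suc t)) (merge-punchIn a y s)) (sym (δ-punchIn s t))

  δ-merge-z : ∀ h → δ (merge a b h) (suc z) ≡ δ h a + δ h b
  δ-merge-z zero = cong (λ v → δ v (suc z)) (merge-sink a y)
  δ-merge-z (suc i) with punchView y i
  ... | self = trans (cong (λ v → δ v (suc z)) merge-b) (trans (δ-refl (suc z))
                 (sym (cong₂ _+_ (δ-≢ {u = b} {a} λ eq → x≢y (sym (suc-injective eq))) (δ-refl b))))
  ... | other s = trans (cong (λ v → δ v (suc z)) (merge-punchIn a y s))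
                    (trans (sym (δ-punchIn s z))
                    (trans (sym (+-identityʳ _)) (cong (δ (suc (punchIn y s)) a +_)
                      (sym (δ-≢ {u = suc (punchIn y s)} {b} λ eq → punchInᵢ≢i y s (suc-injective eq))))))

  δ-ends : ∀ {h} → h ≡ a ⊎ h ≡ b → δ h a + δ h b ≡ 1
  δ-ends (inj₁ refl) = cong₂ _+_ (δ-refl a) (δ-≢ {u = a} {b} λ eq → x≢y (suc-injective eq))
  δ-ends (inj₂ refl) = cong₂ _+_ (δ-≢ {u = b} {a} λ eq → x≢y (sym (suc-injective eq))) (δ-refl b)

  δ-ends-≢ : ∀ {h} → h ≡ a ⊎ h ≡ b → ∀ t → t ≢ z → δ h (suc (punchIn y t)) ≡ 0
  δ-ends-≢ (inj₁ refl) t t≢z = δ-≢ {u = a} λ eq → t≢z (sym (punchIn-injective y z t (suc-injective eq)))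
  δ-ends-≢ (inj₂ refl) t t≢z = δ-≢ {u = b} λ eq → punchInᵢ≢i y t (sym (suc-injective eq))

  contract* : List (Edge (suc n)) → List (Edge n)
  contract* = map (contractEdge (a , b))

  hd-merge : ∀ p u w → hd p (merge a b u , merge a b w) ≡ merge a b (hd p (u , w))
  hd-merge true  u w = refl
  hd-merge false u w = refl

  -- A copy of e always points at one of the two merged ends, so its replacement, the edge to the
  -- sink, has to be turned towards the merged vertex; `false` does that. Every other edge keeps its
  -- direction.
  pushBit : ∀ p e → ∃[ p′ ] (∀ t → t ≢ z → δ (hd p e) (suc (punchIn y t)) ≤ δ (hd p′ (contractEdge (a , b) e)) (suc t))
            × δ (hd p e) a + δ (hd p e) b ≤ δ (hd p′ (contractEdge (a , b) e)) (suc z)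
  pushBit p e@(u , w) with sameEdge e (a , b) in eq
  ... | true  = false
              , (λ t t≢z → ≤-trans (≤-reflexive (δ-ends-≢ (sameEdge-hd e (a , b) eq p) t t≢z)) z≤n)
              , ≤-reflexive (trans (δ-ends (sameEdge-hd e (a , b) eq p))
                  (sym (trans (cong (λ v → δ v (suc z)) (merge-punchIn a y z)) (δ-refl (suc z)))))
  ... | false = p
              , (λ t t≢z → ≤-reflexive (sym (trans (cong (λ v → δ v (suc t)) (hd-merge p u w)) (δ-merge-≢ (hd p e) t t≢z))))
              , ≤-reflexive (sym (trans (cong (λ v → δ v (suc z)) (hd-merge p u w)) (δ-merge-z (hd p e))))

  -- Here the bit is kept even for a copy of e: whichever way it points, it gives one unit to x and
  -- y together, and its replacement gives the merged vertex at most one.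
  pullBit : ∀ p e → (∀ t → t ≢ z → δ (hd p (contractEdge (a , b) e)) (suc t) ≤ δ (hd p e) (suc (punchIn y t)))
            × δ (hd p (contractEdge (a , b) e)) (suc z) ≤ δ (hd p e) a + δ (hd p e) b
  pullBit p e@(u , w) with sameEdge e (a , b) in eq
  ... | true  = (λ t t≢z → ≤-trans (≤-reflexive (spoke p t t≢z)) z≤n)
              , ≤-trans (δ≤1 (hd p (merge a b a , sink)) (suc z)) (≤-reflexive (sym (δ-ends (sameEdge-hd e (a , b) eq p))))
    where
    spoke : ∀ p t → t ≢ z → δ (hd p (merge a b a , sink)) (suc t) ≡ 0
    spoke true  t t≢z = refl
    spoke false t t≢z = trans (cong (λ v → δ v (suc t)) (merge-punchIn a y z)) (δ-≢ λ q → t≢z (sym (suc-injective q)))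
  ... | false = (λ t t≢z → ≤-reflexive (trans (cong (λ v → δ v (suc t)) (hd-merge p u w)) (δ-merge-≢ (hd p e) t t≢z)))
              , ≤-reflexive (trans (cong (λ v → δ v (suc z)) (hd-merge p u w)) (δ-merge-z (hd p e)))

  push : ∀ es (o : Orientation es) → ∃[ o′ ]
         (∀ t → t ≢ z → indeg es o (suc (punchIn y t)) ≤ indeg (contract* es) o′ (suc t))
         × indeg es o a + indeg es o b ≤ indeg (contract* es) o′ (suc z)
  push []       []      = [] , (λ _ _ → z≤n) , z≤n
  push (e ∷ es) (p ∷ o)
    with p′ , off , at ← pushBit p e | o′ , offs , ats ← push es o
    = p′ ∷ o′ , (λ t t≢z → +-mono-≤ (off t t≢z) (offs t t≢z))
    , ≤-trans (≤-reflexive (interchange (δ (hd p e) a) (indeg es o a) (δ (hd p e) b) (indeg es o b))) (+-mono-≤ at ats)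

  pull : ∀ es (o : Orientation (contract* es)) → ∃[ o′ ]
         (∀ t → t ≢ z → indeg (contract* es) o (suc t) ≤ indeg es o′ (suc (punchIn y t)))
         × indeg (contract* es) o (suc z) ≤ indeg es o′ a + indeg es o′ b
  pull []       []      = [] , (λ _ _ → z≤n) , z≤n
  pull (e ∷ es) (p ∷ o)
    with off , at ← pullBit p e | o′ , offs , ats ← pull es o
    = p ∷ o′ , (λ t t≢z → +-mono-≤ (off t t≢z) (offs t t≢z))
    , ≤-trans (+-mono-≤ at ats) (≤-reflexive (interchange (δ (hd p e) a) (δ (hd p e) b) (indeg es o′ a) (indeg es o′ b)))

  -- The lacking vectors merging to M are split M i for i ≤ M z.
  split : Vec ℕ n → ℕ → Vec ℕ (suc n)
  split M i = insertAt (M [ z ]≔ (Vec.lookup M z ∸ i)) y i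

  unsplit : Vec ℕ (suc n) → Vec ℕ n
  unsplit ℓ = updateAt (Vec.removeAt ℓ y) z (Vec.lookup ℓ y +_)

  split-y : ∀ M i → Vec.lookup (split M i) y ≡ i
  split-y M i = insertAt-lookup (M [ z ]≔ (Vec.lookup M z ∸ i)) y i

  split-x : ∀ M i → Vec.lookup (split M i) x ≡ Vec.lookup M z ∸ i
  split-x M i = trans (insertAt-punchIn (M [ z ]≔ (Vec.lookup M z ∸ i)) y i z) (lookup∘update z M _)

  split-≢ : ∀ M i {t} → t ≢ z → Vec.lookup (split M i) (punchIn y t) ≡ Vec.lookup M t
  split-≢ M i {t} t≢z = trans (insertAt-punchIn (M [ z ]≔ (Vec.lookup M z ∸ i)) y i t) (lookup∘update′ t≢z M _)

  sum-split : ∀ M {i} → i ≤ Vec.lookup M z → sumV (split M i) ≡ sumV M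
  sum-split M {i} i≤ = +-cancelʳ-≡ (Vec.lookup M z) _ _ (begin
    sumV (split M i) + Vec.lookup M z  ≡⟨ cong (_+ Vec.lookup M z) (sum-insertAt (M [ z ]≔ (Vec.lookup M z ∸ i)) y i) ⟩
    i + sumV (M [ z ]≔ (Vec.lookup M z ∸ i)) + Vec.lookup M z ≡⟨ +-assoc i _ _ ⟩
    i + (sumV (M [ z ]≔ (Vec.lookup M z ∸ i)) + Vec.lookup M z) ≡⟨ cong (i +_) (sum-updateAt M z _) ⟩
    i + (Vec.lookup M z ∸ i + sumV M) ≡⟨ sym (+-assoc i _ _) ⟩
    i + (Vec.lookup M z ∸ i) + sumV M ≡⟨ cong (_+ sumV M) (m+[n∸m]≡n i≤) ⟩
    Vec.lookup M z + sumV M ≡⟨ +-comm (Vec.lookup M z) _ ⟩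
    sumV M + Vec.lookup M z ∎)
    where open ≡-Reasoning

  unsplit-z : ∀ ℓ → Vec.lookup (unsplit ℓ) z ≡ Vec.lookup ℓ y + Vec.lookup (Vec.removeAt ℓ y) z
  unsplit-z ℓ = lookup∘updateAt z (Vec.removeAt ℓ y)

  y≤unsplit : ∀ ℓ → Vec.lookup ℓ y ≤ Vec.lookup (unsplit ℓ) z
  y≤unsplit ℓ = ≤-trans (m≤m+n _ _) (≤-reflexive (sym (unsplit-z ℓ)))

  split-unsplit : ∀ ℓ → split (unsplit ℓ) (Vec.lookup ℓ y) ≡ ℓ
  split-unsplit ℓ = trans (cong (λ v → insertAt v y (Vec.lookup ℓ y)) eq) (insertAt-removeAt ℓ y)
    where
    eq : unsplit ℓ [ z ]≔ (Vec.lookup (unsplit ℓ) z ∸ Vec.lookup ℓ y) ≡ Vec.removeAt ℓ y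
    eq = trans (Vecₚ.updateAt-updateAt z (Vec.removeAt ℓ y))
      (Vecₚ.updateAt-id-local z (Vec.removeAt ℓ y)
        (trans (cong (_∸ Vec.lookup ℓ y) (unsplit-z ℓ)) (m+n∸m≡n (Vec.lookup ℓ y) _)))

  unsplit-split : ∀ M {i} → i ≤ Vec.lookup M z → unsplit (split M i) ≡ M
  unsplit-split M {i} i≤ = begin
    updateAt (Vec.removeAt (split M i) y) z (Vec.lookup (split M i) y +_)
      ≡⟨ cong₂ (λ v j → updateAt v z (j +_)) (removeAt-insertAt (M [ z ]≔ (Vec.lookup M z ∸ i)) y i) (split-y M i) ⟩
    updateAt (M [ z ]≔ (Vec.lookup M z ∸ i)) z (i +_)
      ≡⟨ Vecₚ.updateAt-updateAt z M ⟩
    updateAt M z (λ _ → i + (Vec.lookup M z ∸ i))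
      ≡⟨ Vecₚ.updateAt-id-local z M (m+[n∸m]≡n i≤) ⟩
    M ∎
    where open ≡-Reasoning

  sum-unsplit : ∀ ℓ → sumV (unsplit ℓ) ≡ sumV ℓ
  sum-unsplit ℓ = trans (sym (sum-split (unsplit ℓ) (y≤unsplit ℓ))) (cong sumV (split-unsplit ℓ))

  module _ (es : List (Edge (suc n))) (e : Fin (length es)) (e≡ : lookup es e ≡ (a , b)) where

    private
      es⁻ = removeAt es e
      es′ = contract* es⁻

    -- The strict bounds at x and y leave two units to spare. The edge e accounts for exactly one of
    -- them, and the other makes the bound at the merged vertex strict.
    merged-feasible : ∀ M {i} → i ≤ Vec.lookup M z → Feasible es (split M i) → Feasible es′ M
    merged-feasible M {i} i≤ (o , ℓ<o)
      with p , o₁ , eq ← removeBit-xy es e x≢y e≡ o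
      with o′ , off , at ← push es⁻ o₁ = o′ , bound
      where
      open ≤-Reasoning
      h = hd p (a , b)

      bound : ∀ t → Vec.lookup M t < indeg es′ o′ (suc t)
      bound t with t ≟ z
      ... | no t≢z = begin-strict
        Vec.lookup M t                        ≡⟨ sym (split-≢ M i t≢z) ⟩
        Vec.lookup (split M i) (punchIn y t)  <⟨ ℓ<o (punchIn y t) ⟩
        indeg es o (suc (punchIn y t))        ≡⟨ eq _ ⟩
        δ h (suc (punchIn y t)) + indeg es⁻ o₁ (suc (punchIn y t))
          ≡⟨ cong (_+ indeg es⁻ o₁ (suc (punchIn y t))) (hd-other es e x≢y e≡ p (λ q → t≢z (punchIn-injective y t z q)) (punchInᵢ≢i y t)) ⟩
        indeg es⁻ o₁ (suc (punchIn y t))      ≤⟨ off t t≢z ⟩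
        indeg es′ o′ (suc t)                  ∎
      ... | yes refl = ≤-trans (≤-pred (begin
        suc (suc (Vec.lookup M z))           ≡⟨ cong (2 +_) (sym (m∸n+n≡m i≤)) ⟩
        suc (suc (Vec.lookup M z ∸ i + i))   ≡⟨ cong suc (sym (+-suc _ i)) ⟩
        suc (Vec.lookup M z ∸ i) + suc i     ≤⟨ +-mono-≤ (subst (_< indeg es o a) (split-x M i) (ℓ<o x)) (subst (_< indeg es o b) (split-y M i) (ℓ<o y)) ⟩
        indeg es o a + indeg es o b          ≡⟨ cong₂ _+_ (eq a) (eq b) ⟩
        (δ h a + indeg es⁻ o₁ a) + (δ h b + indeg es⁻ o₁ b) ≡⟨ interchange (δ h a) _ (δ h b) _ ⟩
        (δ h a + δ h b) + (indeg es⁻ o₁ a + indeg es⁻ o₁ b) ≡⟨ cong (_+ (indeg es⁻ o₁ a + indeg es⁻ o₁ b)) (δ-ends (hd-end p)) ⟩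
        suc (indeg es⁻ o₁ a + indeg es⁻ o₁ b) ∎)) at
        where
        hd-end : ∀ p → hd p (a , b) ≡ a ⊎ hd p (a , b) ≡ b
        hd-end true  = inj₂ refl
        hd-end false = inj₁ refl

    -- Let A and B be the indegrees of x and y without e. The pulled-back orientation gives M z < A
    -- + B, and the unit of e makes both bounds strict provided that it goes to the end that needs
    -- it.
    split-feasible : ∀ M → Feasible es′ M → ∃[ i ] i ≤ Vec.lookup M z × Feasible es (split M i)
    split-feasible M (o′ , M<o′) with o , off , at ← pull es⁻ o′ = go (indeg es⁻ o a) refl
      where
      build : ∀ p i → Vec.lookup M z ∸ i < δ (hd p (a , b)) a + indeg es⁻ o a →
              i < δ (hd p (a , b)) b + indeg es⁻ o b → Feasible es (split M i)
      build p i ax by with o₁ , eq ← insertBit-xy es e x≢y e≡ p o = o₁ , bound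
        where
        bound : ∀ t → Vec.lookup (split M i) t < indeg es o₁ (suc t)
        bound t with punchView y t
        ... | self = subst (_< indeg es o₁ b) (sym (split-y M i)) (<-≤-trans by (≤-reflexive (sym (eq b))))
        ... | other s with s ≟ z
        ...   | yes refl = subst (_< indeg es o₁ a) (sym (split-x M i)) (<-≤-trans ax (≤-reflexive (sym (eq a))))
        ...   | no s≢z = subst (_< indeg es o₁ _) (sym (split-≢ M i s≢z))
                  (<-≤-trans (M<o′ s) (≤-trans (off s s≢z) (≤-trans (m≤n+m _ _) (≤-reflexive (sym (eq _))))))

      total : Vec.lookup M z < indeg es⁻ o a + indeg es⁻ o b
      total = <-≤-trans (M<o′ z) at

      go : ∀ k → indeg es⁻ o a ≡ k → ∃[ i ] i ≤ Vec.lookup M z × Feasible es (split M i)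
      -- With A = 0 everything has to be lacking at y, where B alone suffices; e goes to x.
      go zero    k≡ = Vec.lookup M z , ≤-refl , build false (Vec.lookup M z)
        (≤-trans (s≤s (≤-reflexive (n∸n≡0 (Vec.lookup M z)))) (≤-trans (≤-reflexive (sym (δ-refl a))) (m≤m+n _ _)))
        (≤-trans total (≤-trans (≤-reflexive (cong (_+ indeg es⁻ o b) k≡)) (m≤n+m _ _)))
      go (suc k) k≡ with indeg es⁻ o b ≤? Vec.lookup M z
      -- With i = B it is y that needs e, while x keeps M z ∸ B < A.
      ... | yes q≤ = indeg es⁻ o b , q≤ , build true (indeg es⁻ o b)
        (≤-trans (≤-trans (m<n+o⇒m∸n<o (Vec.lookup M z) (indeg es⁻ o b) (<-≤-trans total (≤-reflexive (trans (cong (_+ indeg es⁻ o b) k≡) (+-comm (suc k) _))))) (≤-reflexive (sym k≡))) (m≤n+m _ _))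
        (≤-reflexive (cong (_+ indeg es⁻ o b) (sym (δ-refl b))))
      -- Now A is positive and B exceeds M z, so either direction of e would do.
      ... | no q≰ = Vec.lookup M z , ≤-refl , build true (Vec.lookup M z)
        (≤-trans (s≤s (≤-reflexive (n∸n≡0 (Vec.lookup M z)))) (≤-trans (≤-trans (s≤s z≤n) (≤-reflexive (sym k≡))) (m≤n+m _ _)))
        (≤-trans (≰⇒> q≰) (m≤n+m _ _))

    -- The bijection between lacking vectors

    private
      _⁻ʸ _⁺ʸ : Vec ℕ (suc n) → Vec ℕ (suc n)
      ℓ ⁻ʸ = updateAt ℓ y pred
      ℓ ⁺ʸ = updateAt ℓ y suc

    -- Positivity is demanded because `pred` fixes 0. The predicate thus describes exactly the image
    -- of the lacking vectors of the deletion under raising at y.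
    Lowerable : Vec ℕ (suc n) → Set
    Lowerable ℓ = 0 < Vec.lookup ℓ y × Feasible es⁻ (ℓ ⁻ʸ)

    lowerable? : Decidable Lowerable
    lowerable? ℓ = (0 <? Vec.lookup ℓ y) ×-dec feasible? es⁻ (ℓ ⁻ʸ)

    -- Beyond `M z` the truncated subtraction in `split` would no longer preserve the sum, hence
    -- this bound for the search.
    minimal : Vec ℕ n → ℕ
    minimal M = least (λ i → feasible? es (split M i)) (Vec.lookup M z)

    forward : Vec ℕ (suc n) → Vec ℕ (suc n) ⊎ Vec ℕ n
    forward ℓ with lowerable? ℓ
    ... | yes _ = inj₁ (ℓ ⁻ʸ)
    ... | no  _ = inj₂ (unsplit ℓ)

    backward : Vec ℕ (suc n) ⊎ Vec ℕ n → Vec ℕ (suc n)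
    backward (inj₁ ℓ) = ℓ ⁺ʸ
    backward (inj₂ M) = split M (minimal M)

    Source : ℕ → Vec ℕ (suc n) → Set
    Source k ℓ = Feasible es ℓ × sumV ℓ ≡ k

    Target : ℕ → Vec ℕ (suc n) ⊎ Vec ℕ n → Set
    Target k (inj₁ ℓ) = Feasible es⁻ ℓ × suc (sumV ℓ) ≡ k
    Target k (inj₂ M) = Feasible es′ M × sumV M ≡ k

    suc-pred-lookup : ∀ ℓ → 0 < Vec.lookup ℓ y → suc (Vec.lookup (ℓ ⁻ʸ) y) ≡ Vec.lookup ℓ y
    suc-pred-lookup ℓ 0<ℓy = trans (cong suc (lookup∘updateAt y ℓ)) (suc-pred (Vec.lookup ℓ y) {{>-nonZero 0<ℓy}})

    raise-lower : ∀ ℓ → 0 < Vec.lookup ℓ y → (ℓ ⁻ʸ) ⁺ʸ ≡ ℓ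
    raise-lower ℓ 0<ℓy = trans (Vecₚ.updateAt-updateAt y ℓ) (Vecₚ.updateAt-id-local y ℓ (suc-pred (Vec.lookup ℓ y) {{>-nonZero 0<ℓy}}))

    lower-raise : ∀ ℓ → (ℓ ⁺ʸ) ⁻ʸ ≡ ℓ
    lower-raise ℓ = trans (Vecₚ.updateAt-updateAt y ℓ) (Vecₚ.updateAt-id y ℓ)

    sum-raise : ∀ ℓ → sumV (ℓ ⁺ʸ) ≡ suc (sumV ℓ)
    sum-raise ℓ = +-cancelʳ-≡ (Vec.lookup ℓ y) _ _ (trans (sum-updateAt ℓ y suc) (cong suc (+-comm (Vec.lookup ℓ y) _)))

    -- Put e back directed at y, where it pays for the added unit.
    raise-feasible : ∀ ℓ → Feasible es⁻ ℓ → Feasible es (ℓ ⁺ʸ)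
    raise-feasible ℓ (o , ℓ<o) with o₁ , eq ← insertBit-xy es e x≢y e≡ true o = o₁ , bound
      where
      bound : ∀ t → Vec.lookup (ℓ ⁺ʸ) t < indeg es o₁ (suc t)
      bound t with t ≟ y
      ... | yes refl = ≤-trans (s≤s (≤-reflexive (lookup∘updateAt y ℓ)))
            (≤-trans (s≤s (ℓ<o y)) (≤-reflexive (sym (trans (eq b) (cong (_+ indeg es⁻ o b) (δ-refl b))))))
      ... | no t≢y = ≤-trans (s≤s (≤-reflexive (lookup∘updateAt′ t y t≢y ℓ)))
            (≤-trans (ℓ<o t) (≤-trans (m≤n+m _ _) (≤-reflexive (sym (eq (suc t))))))

    minimal-feasible : ∀ M → Feasible es′ M → Feasible es (split M (minimal M))
    minimal-feasible M feas with i , i≤ , f ← split-feasible M feas =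
      least-satisfies (λ i → feasible? es (split M i)) i≤ f

    minimal-≤ : ∀ M {i} → i ≤ Vec.lookup M z → Feasible es (split M i) → minimal M ≤ i
    minimal-≤ M = least-≤ (λ i → feasible? es (split M i))

    minimal-≤z : ∀ M → Feasible es′ M → minimal M ≤ Vec.lookup M z
    minimal-≤z M feas with i , i≤ , f ← split-feasible M feas = ≤-trans (minimal-≤ M i≤ f) i≤

    unsplit-feasible : ∀ ℓ → Feasible es ℓ → Feasible es′ (unsplit ℓ)
    unsplit-feasible ℓ feas = merged-feasible (unsplit ℓ) (y≤unsplit ℓ) (subst (Feasible es) (sym (split-unsplit ℓ)) feas)

    -- A smaller entry at y means a larger one at x, so the split at j can serve as the second
    -- vector of `descend-y`.
    non-minimal-lowerable : ∀ M {i j} → j < i → i ≤ Vec.lookup M z →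
      Feasible es (split M j) → Feasible es (split M i) → Lowerable (split M i)
    non-minimal-lowerable M {i} {j} j<i i≤ fj fi =
      0<y , descend-y es e x≢y e≡ {ℓ = split M i} {split M j} {split M i ⁻ʸ}
        (subst₂ _<_ (sym (split-x M i)) (sym (split-x M j)) (∸-monoʳ-< j<i i≤))
        agree
        (suc-pred-lookup (split M i) 0<y)
        (λ t t≢y → lookup∘updateAt′ t y t≢y (split M i))
        fi fj
      where
      0<y : 0 < Vec.lookup (split M i) y
      0<y = ≤-trans (s≤s z≤n) (≤-trans j<i (≤-reflexive (sym (split-y M i))))

      agree : ∀ t → t ≢ x → t ≢ y → Vec.lookup (split M i) t ≡ Vec.lookup (split M j) t
      agree t t≢x t≢y with punchView y t
      ... | self = contradiction refl t≢y
      ... | other s = trans (split-≢ M i s≢z) (sym (split-≢ M j s≢z))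
        where
        s≢z : s ≢ z
        s≢z refl = t≢x refl

    -- Given a witness for the lowered vector, putting e back directed at x instead of y makes the
    -- split at i ∸ 1 feasible, against minimality.
    minimal-not-lowerable : ∀ M → Feasible es′ M → ¬ Lowerable (split M (minimal M))
    minimal-not-lowerable M feas (0<y , f) = <⇒≱ (s≤s ≤-refl) (≤-trans (≤-reflexive (sym i≡))
      (minimal-≤ M (≤-trans (n≤1+n _) (≤-trans (≤-reflexive (sym i≡)) (minimal-≤z M feas))) shifted))
      where
      i = minimal M
      j = pred i

      i≡ : i ≡ suc j
      i≡ = sym (suc-pred i {{>-nonZero (subst (0 <_) (split-y M i) 0<y)}})

      shifted : Feasible es (split M j)
      shifted with o₁ , eq ← insertBit-xy es e x≢y e≡ false (proj₁ f) = o₁ , bound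
        where
        o = proj₁ f
        ℓ<o = proj₂ f

        bound : ∀ t → Vec.lookup (split M j) t < indeg es o₁ (suc t)
        bound t with punchView y t
        ... | self = ≤-trans (s≤s (≤-reflexive (trans (split-y M j) (sym (trans (lookup∘updateAt y (split M i)) (cong pred (split-y M i)))))))
                (≤-trans (ℓ<o y) (≤-trans (m≤n+m _ _) (≤-reflexive (sym (eq b)))))
        ... | other s with s ≟ z
        ...   | yes refl = begin
          suc (Vec.lookup (split M j) x)         ≡⟨ cong suc (split-x M j) ⟩
          suc (Vec.lookup M z ∸ j)               ≡⟨ cong suc (+-∸-assoc 1 (≤-trans (≤-reflexive (sym i≡)) (minimal-≤z M feas))) ⟩
          suc (suc (Vec.lookup M z ∸ suc j))     ≡⟨ cong (λ k → suc (suc (Vec.lookup M z ∸ k))) (sym i≡) ⟩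
          suc (suc (Vec.lookup M z ∸ i))         ≡⟨ cong (2 +_) (sym (trans (lookup∘updateAt′ x y x≢y (split M i)) (split-x M i))) ⟩
          suc (suc (Vec.lookup (split M i ⁻ʸ) x)) ≤⟨ s≤s (ℓ<o x) ⟩
          suc (indeg es⁻ o a)                    ≡⟨ cong (_+ indeg es⁻ o a) (sym (δ-refl a)) ⟩
          δ a a + indeg es⁻ o a                  ≡⟨ sym (eq a) ⟩
          indeg es o₁ a                          ∎
          where open ≤-Reasoning
        ...   | no s≢z = ≤-trans (s≤s (≤-reflexive (trans (split-≢ M j s≢z) (sym (trans (lookup∘updateAt′ _ y (punchInᵢ≢i y s) (split M i)) (split-≢ M i s≢z))))))
                (≤-trans (ℓ<o _) (≤-trans (m≤n+m _ _) (≤-reflexive (sym (eq _)))))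

    forward-target : ∀ {k} ℓ → Source k ℓ → Target k (forward ℓ)
    forward-target ℓ (feas , sum≡) with lowerable? ℓ
    ... | yes (0<y , f) = f , trans (sym (sum-raise (ℓ ⁻ʸ))) (trans (cong sumV (raise-lower ℓ 0<y)) sum≡)
    ... | no  _ = unsplit-feasible ℓ feas , trans (sum-unsplit ℓ) sum≡

    backward-source : ∀ {k} r → Target k r → Source k (backward r)
    backward-source (inj₁ ℓ) (feas , sum≡) = raise-feasible ℓ feas , trans (sum-raise ℓ) sum≡
    backward-source (inj₂ M) (feas , sum≡) = minimal-feasible M feas , trans (sum-split M (minimal-≤z M feas)) sum≡

    backward-forward : ∀ ℓ → Feasible es ℓ → backward (forward ℓ) ≡ ℓ
    backward-forward ℓ feas with lowerable? ℓ
    ... | yes (0<y , _) = raise-lower ℓ 0<y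
    ... | no ¬low = trans (cong (split M) min≡) (split-unsplit ℓ)
      where
      M = unsplit ℓ

      feas′ : Feasible es (split M (Vec.lookup ℓ y))
      feas′ = subst (Feasible es) (sym (split-unsplit ℓ)) feas

      min≡ : minimal M ≡ Vec.lookup ℓ y
      -- A smaller feasible split would make ℓ lowerable.
      min≡ = ≤-antisym (minimal-≤ M (y≤unsplit ℓ) feas′) (≮⇒≥ λ lt → ¬low
        (subst Lowerable (split-unsplit ℓ) (non-minimal-lowerable M lt (y≤unsplit ℓ)
          (minimal-feasible M (unsplit-feasible ℓ feas)) feas′)))

    forward-backward : ∀ {k} r → Target k r → forward (backward r) ≡ r
    forward-backward (inj₁ ℓ) (feas , _) with lowerable? (ℓ ⁺ʸ)
    ... | yes _ = cong inj₁ (lower-raise ℓ)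
    ... | no ¬low = contradiction
      (≤-trans (s≤s z≤n) (≤-reflexive (sym (lookup∘updateAt y ℓ))) , subst (Feasible es⁻) (sym (lower-raise ℓ)) feas) ¬low
    forward-backward (inj₂ M) (feas , _) with lowerable? (split M (minimal M))
    ... | yes low = contradiction low (minimal-not-lowerable M feas)
    ... | no _ = cong inj₂ (unsplit-split M (minimal-≤z M feas))

-- Reachable configurations are oriented

degree : ∀ {n} → List (Edge n) → Vertex n → ℕ
degree es v = length (nbrs es v)

NoLoops : ∀ {n} → List (Edge n) → Set
NoLoops es = All (λ (a , b) → a ≢ b) es

-- `nbrs` lists a loop once, whereas both indicators would count it.
degree-∷ : ∀ {n} (a b : Vertex n) es v → a ≢ b →
           degree ((a , b) ∷ es) v ≡ δ a v + δ b v + degree es v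
degree-∷ a b es v a≢b with a ≟ v | b ≟ v
... | yes refl | yes refl = contradiction refl a≢b
... | yes refl | no _     = refl
... | no _     | yes refl = refl
... | no _     | no _     = refl

δ-hd-tl : ∀ {n} p (a b v : Vertex n) → δ (hd p (a , b)) v + δ (tl p (a , b)) v ≡ δ a v + δ b v
δ-hd-tl true  a b v = +-comm (δ b v) _
δ-hd-tl false a b v = refl

indeg≤degree : ∀ {n} (es : List (Edge n)) o v → indeg es o v ≤ degree es v
indeg≤degree [] [] v = z≤n
indeg≤degree ((a , b) ∷ es) (p ∷ o) v with a ≟ v | b ≟ v
indeg≤degree ((a , b) ∷ es) (p ∷ o) v | yes _ | _ = +-mono-≤ (δ≤1 (hd p (a , b)) v) (indeg≤degree es o v)
indeg≤degree ((a , b) ∷ es) (p ∷ o) v | no _ | yes _ = +-mono-≤ (δ≤1 (hd p (a , b)) v) (indeg≤degree es o v)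
indeg≤degree ((a , b) ∷ es) (true  ∷ o) v | no _ | no b≢v = ≤-trans (≤-reflexive (cong (_+ indeg es o v) (δ-≢ b≢v))) (indeg≤degree es o v)
indeg≤degree ((a , b) ∷ es) (false ∷ o) v | no a≢v | no _ = ≤-trans (≤-reflexive (cong (_+ indeg es o v) (δ-≢ a≢v))) (indeg≤degree es o v)

received : ∀ {n} (vs : List (Vertex n)) → Vec Bool (length vs) → Vertex n → ℕ
received []       []          t = 0
received (v ∷ vs) (true  ∷ c) t = δ v t + received vs c t
received (v ∷ vs) (false ∷ c) t = received vs c t

lookup-addGrain : ∀ {n} (η : Config n) j i → Vec.lookup (addGrain η j) i ≡ δ j i + Vec.lookup η i
lookup-addGrain η j i with j ≟ i
... | yes refl = lookup∘updateAt j η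
... | no j≢i   = lookup∘updateAt′ i j (j≢i ∘ sym) η

lookup-give : ∀ {n} (η : Config n) v i → Vec.lookup (give η v) i ≡ δ v (suc i) + Vec.lookup η i
lookup-give η zero    i = refl
lookup-give η (suc j) i = trans (lookup-addGrain η j i) (cong (_+ Vec.lookup η i) (δ-suc j i))
  where
  δ-suc : ∀ {m} (j i : Fin m) → δ j i ≡ δ (suc j) (suc i)
  δ-suc j i with j ≟ i
  ... | yes _ = refl
  ... | no _  = refl

lookup-send : ∀ {n} (η : Config n) vs c i → Vec.lookup (send η vs c) i ≡ Vec.lookup η i + received vs c (suc i)
lookup-send η []       []          i = sym (+-identityʳ _)
lookup-send η (v ∷ vs) (true  ∷ c) i = trans (lookup-give (send η vs c) v i)
  (trans (cong (δ v (suc i) +_) (lookup-send η vs c i)) (left-comm (δ v (suc i)) (Vec.lookup η i) _))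
lookup-send η (v ∷ vs) (false ∷ c) i = lookup-send η vs c i

module _ {n} (G : Graph n) where

  private
    es = edges G

  topple-self : ∀ η i c → Vec.lookup (topple G η i c) i ≡ Vec.lookup η i ∸ count c + received (nbrs es (suc i)) c (suc i)
  topple-self η i c = trans (lookup-send (updateAt η i (_∸ count c)) (nbrs es (suc i)) c i)
    (cong (_+ received (nbrs es (suc i)) c (suc i)) (lookup∘updateAt i η))

  topple-other : ∀ η i c {j} → j ≢ i → Vec.lookup (topple G η i c) j ≡ Vec.lookup η j + received (nbrs es (suc i)) c (suc j)
  topple-other η i c {j} j≢i = trans (lookup-send (updateAt η i (_∸ count c)) (nbrs es (suc i)) c j)
    (cong (_+ received (nbrs es (suc i)) c (suc j)) (lookup∘updateAt′ j i j≢i η))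

-- Edges at v that carry a grain are turned towards v, the others away from it. A neighbour can thus
-- lose an incoming edge only where it receives a grain.
reorient : ∀ {n} (es : List (Edge n)) v c (o : Orientation es) → ∃[ o′ ]
           count c ≤ indeg es o′ v × (∀ u → u ≢ v → indeg es o u ≤ indeg es o′ u + received (nbrs es v) c u)
reorient [] v [] [] = [] , z≤n , λ _ _ → z≤n
reorient ((a , b) ∷ es) v c (p ∷ o) with a ≟ v | b ≟ v
reorient ((a , b) ∷ es) v (true ∷ c) (p ∷ o) | yes refl | _
  with o′ , at , off ← reorient es v c o
  = false ∷ o′ , +-mono-≤ (≤-reflexive (sym (δ-refl a))) at
  , λ u u≢v → ≤-trans (+-mono-≤ (bit p u) (off u u≢v)) (≤-reflexive (interchange (δ a u) (δ b u) _ _))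
  where
  bit : ∀ p u → δ (hd p (a , b)) u ≤ δ a u + δ b u
  bit true  u = m≤n+m _ _
  bit false u = m≤m+n _ _
reorient ((a , b) ∷ es) v (false ∷ c) (p ∷ o) | yes refl | _
  with o′ , at , off ← reorient es v c o
  = true ∷ o′ , ≤-trans at (m≤n+m _ _)
  , λ u u≢v → ≤-trans (+-mono-≤ (bit p u u≢v) (off u u≢v)) (≤-reflexive (sym (+-assoc (δ b u) _ _)))
  where
  bit : ∀ p u → u ≢ a → δ (hd p (a , b)) u ≤ δ b u
  bit true  u u≢a = ≤-refl
  bit false u u≢a = ≤-trans (≤-reflexive (δ-≢ (u≢a ∘ sym))) z≤n
reorient ((a , b) ∷ es) v (true ∷ c) (p ∷ o) | no _ | yes refl
  with o′ , at , off ← reorient es v c o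
  = true ∷ o′ , +-mono-≤ (≤-reflexive (sym (δ-refl b))) at
  , λ u u≢v → ≤-trans (+-mono-≤ (bit p u) (off u u≢v)) (≤-reflexive (interchange (δ b u) (δ a u) _ _))
  where
  bit : ∀ p u → δ (hd p (a , b)) u ≤ δ b u + δ a u
  bit true  u = m≤m+n _ _
  bit false u = m≤n+m _ _
reorient ((a , b) ∷ es) v (false ∷ c) (p ∷ o) | no _ | yes refl
  with o′ , at , off ← reorient es v c o
  = false ∷ o′ , ≤-trans at (m≤n+m _ _)
  , λ u u≢v → ≤-trans (+-mono-≤ (bit p u u≢v) (off u u≢v)) (≤-reflexive (sym (+-assoc (δ a u) _ _)))
  where
  bit : ∀ p u → u ≢ b → δ (hd p (a , b)) u ≤ δ a u
  bit true  u u≢b = ≤-trans (≤-reflexive (δ-≢ (u≢b ∘ sym))) z≤n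
  bit false u u≢b = ≤-refl
reorient ((a , b) ∷ es) v c (p ∷ o) | no _ | no _
  with o′ , at , off ← reorient es v c o
  = p ∷ o′ , ≤-trans at (m≤n+m _ _)
  , λ u u≢v → ≤-trans (+-monoʳ-≤ (δ (hd p (a , b)) u) (off u u≢v)) (≤-reflexive (sym (+-assoc (δ (hd p (a , b)) u) _ _)))

Addition : ∀ {n} → Config n → Config n → Set
Addition η η′ = ∃[ i ] η′ ≡ addGrain η i

additions : ∀ {n} (ζ η : Config n) → (∀ i → Vec.lookup ζ i ≤ Vec.lookup η i) → Star Addition ζ η
additions []      []      _   = ε
additions (z ∷ ζ) (y ∷ η) z≤y =
  subst (λ k → Star Addition (z ∷ ζ) (k ∷ ζ)) (m∸n+n≡m (z≤y zero)) (head-additions (y ∸ z))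
  ◅◅ gmap (y ∷_) (λ { (i , refl) → suc i , refl }) (additions ζ η (z≤y ∘ suc))
  where
  head-additions : ∀ k → Star Addition (z ∷ ζ) (k + z ∷ ζ)
  head-additions zero    = ε
  head-additions (suc k) = head-additions k ◅◅ ((zero , refl) ◅ ε)

-- Extends the characterisation of the recurrent configurations to unstable ones.
Oriented : ∀ {n} → Graph n → Config n → Set
Oriented G η = ∃[ o ] ∀ i → deg G (suc i) < indeg (edges G) o (suc i) + Vec.lookup η i

module _ {n} (G : Graph n) where

  private
    es = edges G

  addGrain-oriented : ∀ {η} i → Oriented G η → Oriented G (addGrain η i)
  addGrain-oriented {η} i (o , d<) = o , λ j → <-≤-trans (d< j)
    (+-monoʳ-≤ _ (≤-trans (m≤n+m _ (δ i j)) (≤-reflexive (sym (lookup-addGrain η i j)))))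

  -- An unstable vertex needs no incoming edges, so the edges carrying a grain may be
  -- turned towards it, which pays for the grains it loses, and its other edges away from it.
  toppleStep-oriented : ∀ {η η′} → ToppleStep G η η′ → Oriented G η → Oriented G η′
  toppleStep-oriented {η} (step i d<η c) (o , d<)
    with o′ , at , off ← reorient es (suc i) c o = o′ , bound
    where
    open ≤-Reasoning
    bound : ∀ j → deg G (suc j) < indeg es o′ (suc j) + Vec.lookup (topple G η i c) j
    bound j with j ≟ i
    ... | yes refl = begin-strict
      deg G (suc i)                                       <⟨ d<η ⟩
      Vec.lookup η i                                      ≤⟨ m≤n+m∸n _ (count c) ⟩
      count c + (Vec.lookup η i ∸ count c)                ≤⟨ +-mono-≤ at (m≤m+n _ _) ⟩
      indeg es o′ (suc i) + (Vec.lookup η i ∸ count c + received (nbrs es (suc i)) c (suc i))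
        ≡⟨ cong (indeg es o′ (suc i) +_) (sym (topple-self G η i c)) ⟩
      indeg es o′ (suc i) + Vec.lookup (topple G η i c) i ∎
    ... | no j≢i = begin-strict
      deg G (suc j)                                       <⟨ d< j ⟩
      indeg es o (suc j) + Vec.lookup η j
        ≤⟨ +-monoˡ-≤ (Vec.lookup η j) (off (suc j) (λ eq → j≢i (suc-injective eq))) ⟩
      indeg es o′ (suc j) + received (nbrs es (suc i)) c (suc j) + Vec.lookup η j
        ≡⟨ trans (+-assoc (indeg es o′ (suc j)) _ _) (cong (indeg es o′ (suc j) +_) (+-comm (received (nbrs es (suc i)) c (suc j)) _)) ⟩
      indeg es o′ (suc j) + (Vec.lookup η j + received (nbrs es (suc i)) c (suc j))
        ≡⟨ cong (indeg es o′ (suc j) +_) (sym (topple-other G η i c j≢i)) ⟩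
      indeg es o′ (suc j) + Vec.lookup (topple G η i c) j ∎

  topplings-oriented : ∀ {η η′} → Star (ToppleStep G) η η′ → Oriented G η → Oriented G η′
  topplings-oriented ε        p = p
  topplings-oriented (s ◅ ss) p = topplings-oriented ss (toppleStep-oriented s p)

  reachable-oriented : ∀ {η η′} → Star (Transition G) η η′ → Stable G η × Oriented G η → Stable G η′ × Oriented G η′
  reachable-oriented ε p = p
  reachable-oriented {η} ((_ , i , ss , st) ◅ ts) (_ , p) =
    reachable-oriented ts (st , topplings-oriented ss (addGrain-oriented {η} i p))

  -- All intermediate configurations lie below η, hence are stable, and each addition is a
  -- transition with an empty stabilisation.
  additions-transitions : ∀ {ζ η} → Star Addition ζ η → Stable G η → Stable G ζ × Star (Transition G) ζ η
  additions-transitions ε st = st , ε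
  additions-transitions {ζ} ((i , refl) ◅ as) st with st₁ , ts ← additions-transitions as st =
    st₀ , (st₀ , i , ε , st₁) ◅ ts
    where
    st₀ : Stable G ζ
    st₀ j = ≤-trans (m≤n+m _ (δ i j)) (≤-trans (≤-reflexive (sym (lookup-addGrain ζ i j))) (proj₁ (additions-transitions as st) j))

  raise : ∀ {ζ η : Config n} → (∀ i → Vec.lookup ζ i ≤ Vec.lookup η i) → Stable G η → Star (Transition G) ζ η
  raise ζ≤η st = proj₂ (additions-transitions (additions _ _ ζ≤η) st)

pick-none : ∀ {n} (vs : List (Vertex n)) → ∃[ c ] count {length vs} c ≡ 0 × (∀ t → received vs c t ≡ 0)
pick-none []       = [] , refl , λ _ → refl
pick-none (v ∷ vs) with c , none , r ← pick-none vs = false ∷ c , none , r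

pick : ∀ {n} {v : Vertex n} {vs} → v ∈ vs → ∃[ c ] count c ≡ 1 × (∀ t → received vs c t ≡ δ v t)
pick {v = v} {vs = _ ∷ vs} (here refl) with c , none , r ← pick-none vs =
  true ∷ c , cong suc none , λ t → trans (cong (δ v t +_) (r t)) (+-identityʳ _)
pick (there v∈vs) with c , one , r ← pick v∈vs = false ∷ c , one , r

adjacent-nbr : ∀ {n} {G : Graph n} {w u} → Adj G w u → u ∈ nbrs (edges G) w
adjacent-nbr {G = G} (adj i eq) = go (edges G) i eq
  where
  go : ∀ es i {w u} → lookup es i ≡ (w , u) ⊎ lookup es i ≡ (u , w) → u ∈ nbrs es w
  go ((a , b) ∷ es) i       {w} eq with a ≟ w | b ≟ w
  go ((a , b) ∷ es) zero    (inj₁ refl) | yes _   | _      = here refl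
  go ((a , b) ∷ es) zero    (inj₁ refl) | no a≢a  | _      = contradiction refl a≢a
  go ((a , b) ∷ es) zero    (inj₂ refl) | yes a≡b | _      = here a≡b
  go ((a , b) ∷ es) zero    (inj₂ refl) | no _    | yes _  = here refl
  go ((a , b) ∷ es) zero    (inj₂ refl) | no _    | no b≢b = contradiction refl b≢b
  go ((a , b) ∷ es) (suc i) eq          | yes _   | _      = there (go es i eq)
  go ((a , b) ∷ es) (suc i) eq          | no _    | yes _  = there (go es i eq)
  go ((a , b) ∷ es) (suc i) eq          | no _    | no _   = go es i eq

adj-sym : ∀ {n} {G : Graph n} {u v} → Adj G u v → Adj G v u
adj-sym (adj i (inj₁ eq)) = adj i (inj₂ eq)
adj-sym (adj i (inj₂ eq)) = adj i (inj₁ eq)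

-- Every vertex is adjacent to a later one, and the last one is the sink.
data Ordering {n} (G : Graph n) : List (Vertex n) → Set where
  base : Ordering G (sink ∷ [])
  grow : ∀ {j u vs} → suc j ∉ vs → u ∈ vs → Adj G (suc j) u → Ordering G vs → Ordering G (suc j ∷ vs)

module _ {n} {G : Graph n} where

  open DecMembership (_≟_ {suc n}) using (_∈?_)

  sink∈ordering : ∀ {vs} → Ordering G vs → sink ∈ vs
  sink∈ordering base             = here refl
  sink∈ordering (grow _ _ _ ord) = there (sink∈ordering ord)

  Extension : List (Vertex n) → (List (Vertex n) → Set) → Set
  Extension vs P = ∃[ ws ] Ordering G ws × (∀ {t} → t ∈ vs → t ∈ ws) × P ws

  -- A vertex of the path that is not yet listed is put in front; its predecessor on the path is
  -- listed already and serves as its later neighbour.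
  follow : ∀ {vs u v} → Ordering G vs → u ∈ vs → Star (Adj G) u v → Extension vs (v ∈_)
  follow {vs} ord u∈ ε = vs , ord , (λ t∈ → t∈) , u∈
  follow {vs} ord u∈ (_◅_ {j = w} a as) with w ∈? vs
  ... | yes w∈ = follow ord w∈ as
  follow {vs} ord u∈ (_◅_ {j = zero} a as) | no w∉ = contradiction (sink∈ordering ord) w∉
  follow {vs} ord u∈ (_◅_ {j = suc j} a as) | no w∉
    with ws , ord′ , sub , v∈ ← follow (grow w∉ u∈ (adj-sym a) ord) (here refl) as
    = ws , ord′ , sub ∘ there , v∈

  cover : Connected G → ∀ ts → Extension [] (λ ws → All (_∈ ws) ts)
  cover conn [] = sink ∷ [] , base , (λ ()) , []
  cover conn (t ∷ ts) with vs , ord , _ , all ← cover conn ts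
    with ws , ord′ , sub , t∈ ← follow ord (sink∈ordering ord) (conn t)
    = ws , ord′ , (λ ()) , t∈ ∷ All.map sub all

  connected-ordering : Connected G → ∃[ vs ] Ordering G vs × (∀ v → v ∈ vs)
  connected-ordering conn with vs , ord , _ , all ← cover conn (allFin (suc n)) =
    vs , ord , λ v → All.lookup all (∈-allFin v)

-- The end that is listed first becomes the head. In an ordering every listed vertex except the sink
-- has a later neighbour, and so is the head of some edge.
towards : ∀ {n} → List (Vertex n) → Edge n → Bool
towards []       x       = true
towards (w ∷ vs) (a , b) with w ≟ a | w ≟ b
... | yes _ | _     = false
... | no _  | yes _ = true
... | no _  | no _  = towards vs (a , b)

module _ {n} {G : Graph n} where

  private
    es = edges G

  -- The vertices listed before j differ from j and from its later neighbour, so `towards` skips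
  -- them. Both ways of writing the edge are covered because edges are unordered.
  ordering-parent : ∀ {vs j} → Ordering G vs → suc j ∈ vs → ∃[ u ] u ∈ vs × Adj G (suc j) u ×
    (∀ x → x ≡ (suc j , u) ⊎ x ≡ (u , suc j) → hd (towards vs x) x ≡ suc j)
  ordering-parent base (here ())
  ordering-parent base (there ())
  ordering-parent (grow {j} {u} j∉ u∈ a ord) (here refl) = u , there u∈ , a , first
    where
    first : ∀ x → x ≡ (suc j , u) ⊎ x ≡ (u , suc j) → hd (towards (suc j ∷ _) x) x ≡ suc j
    first (p , q) eq with suc j ≟ p | suc j ≟ q
    first (p , q) eq          | yes refl | _        = refl
    first (p , q) eq          | no _     | yes refl = refl
    first (p , q) (inj₁ refl) | no j≢p   | no _     = contradiction refl j≢p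
    first (p , q) (inj₂ refl) | no _     | no j≢q   = contradiction refl j≢q
  ordering-parent (grow {w} j∉ u∈ a ord) (there {x = _} j∈) with ordering-parent ord j∈
  ordering-parent {vs = _ ∷ vs} {j} (grow {w} w∉ _ _ ord) (there j∈) | u , u∈ , a , first = u , there u∈ , a , later
    where
    w≢ : ∀ {t} → t ∈ vs → suc w ≢ t
    w≢ t∈ refl = w∉ t∈

    later : ∀ x → x ≡ (suc j , u) ⊎ x ≡ (u , suc j) → hd (towards (suc w ∷ vs) x) x ≡ suc j
    later (p , q) eq with suc w ≟ p | suc w ≟ q
    later (p , q) eq          | no _     | no _     = first (p , q) eq
    later (p , q) (inj₁ refl) | yes w≡   | _        = contradiction w≡ (w≢ j∈)
    later (p , q) (inj₁ refl) | no _     | yes w≡   = contradiction w≡ (w≢ u∈)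
    later (p , q) (inj₂ refl) | yes w≡   | _        = contradiction w≡ (w≢ u∈)
    later (p , q) (inj₂ refl) | no _     | yes w≡   = contradiction w≡ (w≢ j∈)

orientation-by : ∀ {n} (f : Edge n → Bool) (es : List (Edge n)) → Orientation es
orientation-by f []       = []
orientation-by f (x ∷ es) = f x ∷ orientation-by f es

orientation-by-positive : ∀ {n} (f : Edge n → Bool) es i {v} →
  hd (f (lookup es i)) (lookup es i) ≡ v → 0 < indeg es (orientation-by f es) v
orientation-by-positive f (x ∷ es) zero    {v} eq = ≤-trans (≤-reflexive (sym (trans (cong (λ h → δ h v) eq) (δ-refl v)))) (m≤m+n _ _)
orientation-by-positive f (x ∷ es) (suc i) eq = ≤-trans (orientation-by-positive f es i eq) (m≤n+m _ _)

maxConfig-stable : ∀ {n} (G : Graph n) → Stable G (maxConfig G)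
maxConfig-stable G i = ≤-reflexive (lookup∘tabulate (λ i → deg G (suc i)) i)

-- At the maximal configuration only one incoming edge is required at each vertex other than the
-- sink.
maxConfig-oriented : ∀ {n} (G : Graph n) → Connected G → Oriented G (maxConfig G)
maxConfig-oriented G conn with vs , ord , all ← connected-ordering conn = o , bound
  where
  o = orientation-by (towards vs) (edges G)

  bound : ∀ i → deg G (suc i) < indeg (edges G) o (suc i) + Vec.lookup (maxConfig G) i
  bound i with u , _ , adj k eq , first ← ordering-parent ord (all (suc i)) =
    +-mono-≤ (orientation-by-positive (towards vs) (edges G) k (first _ eq))
             (≤-reflexive (sym (lookup∘tabulate (λ i → deg G (suc i)) i)))

-- Oriented configurations are reachable

module _ {n} (G : Graph n) where

  private
    es = edges G

  -- A toppling may use a single edge, so each one moves a single grain to u, and exactly k of them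
  -- are possible before j is down to its degree.
  drain : ∀ k (η : Config n) j {u} → Adj G (suc j) u → u ≢ suc j → Vec.lookup η j ≡ k + deg G (suc j) →
          ∃[ η′ ] Star (ToppleStep G) η η′ × Vec.lookup η′ j ≡ deg G (suc j) ×
          (∀ i → i ≢ j → Vec.lookup η i ≤ Vec.lookup η′ i) ×
          (∀ i → i ≢ j → suc i ≢ u → Vec.lookup η′ i ≡ Vec.lookup η i)
  drain zero    η j a u≢ eq = η , ε , eq , (λ _ _ → ≤-refl) , (λ _ _ _ → refl)
  drain (suc k) η j {u} a u≢ eq
    with c , one , r ← pick (adjacent-nbr a)
    with η′ , ss , full , more , same ← drain k (topple G η j c) j a u≢
      (trans (topple-self G η j c) (trans (cong₂ _+_ (cong₂ _∸_ eq one) (trans (r (suc j)) (δ-≢ u≢))) (+-identityʳ _)))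
    = η′ , step j (≤-trans (s≤s (m≤n+m _ k)) (≤-reflexive (sym eq))) c ◅ ss , full
    , (λ i i≢j → ≤-trans (≤-trans (m≤m+n _ _) (≤-reflexive (sym (topple-other G η j c i≢j)))) (more i i≢j))
    , λ i i≢j i≢u → trans (same i i≢j i≢u) (trans (topple-other G η j c i≢j)
        (trans (cong (Vec.lookup η i +_) (trans (r (suc i)) (δ-≢ (i≢u ∘ sym)))) (+-identityʳ _)))

  -- Surplus grains are passed along the ordering until they fall into the sink.
  clear : ∀ {vs} → Ordering G vs → (η : Config n) → (∀ i → suc i ∈ vs → deg G (suc i) ≤ Vec.lookup η i) →
          ∃[ η′ ] Star (ToppleStep G) η η′ × (∀ i → suc i ∈ vs → Vec.lookup η′ i ≡ deg G (suc i)) ×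
          (∀ i → suc i ∉ vs → Vec.lookup η′ i ≡ Vec.lookup η i)
  clear base η _ = η , ε , (λ { i (here ()) ; i (there ()) }) , λ _ _ → refl
  clear (grow {j} {u} {vs} j∉ u∈ a ord) η full
    with η₁ , ss₁ , full₁ , more , same ← drain (Vec.lookup η j ∸ deg G (suc j)) η j a
      (λ { refl → j∉ u∈ }) (sym (m∸n+n≡m (full j (here refl))))
    with η₂ , ss₂ , full₂ , same₂ ← clear ord η₁
      (λ i i∈ → ≤-trans (full i (there i∈)) (more i λ { refl → j∉ i∈ }))
    = η₂ , ss₁ ◅◅ ss₂ , full′ , λ i i∉ → trans (same₂ i (i∉ ∘ there)) (same i (λ { refl → i∉ (here refl) }) (λ { refl → i∉ (there u∈) }))
    where
    full′ : ∀ i → suc i ∈ suc j ∷ vs → Vec.lookup η₂ i ≡ deg G (suc i)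
    full′ i (here refl) = trans (same₂ j j∉) full₁
    full′ i (there i∈) = full₂ i i∈

module _ {n : ℕ} where

  open DecMembership (_≟_ {suc n}) using (_∈?_)

  -- The contribution to the outdegree of u of an edge from t to h, where only
  -- edges leading out of vs count.
  exit : List (Vertex n) → Vertex n → Vertex n → Vertex n → ℕ
  exit vs h t u = if does (h ∈? vs) then 0 else δ t u

  exit-∈ : ∀ {vs h} t u → h ∈ vs → exit vs h t u ≡ 0
  exit-∈ {vs} {h} t u h∈ rewrite dec-true (h ∈? vs) h∈ = refl

  exit-∉ : ∀ {vs h} t u → h ∉ vs → exit vs h t u ≡ δ t u
  exit-∉ {vs} {h} t u h∉ rewrite dec-false (h ∈? vs) h∉ = refl

  exit≤δ : ∀ vs h t u → exit vs h t u ≤ δ t u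
  exit≤δ vs h t u with does (h ∈? vs)
  ... | true  = z≤n
  ... | false = ≤-refl

  exit-anti : ∀ v vs h t u → exit (v ∷ vs) h t u ≤ exit vs h t u
  exit-anti v vs h t u = go (h ∈? vs)
    where
    go : Dec (h ∈ vs) → exit (v ∷ vs) h t u ≤ exit vs h t u
    go (yes h∈) = ≤-trans (≤-reflexive (exit-∈ t u (there h∈))) z≤n
    go (no h∉)  = ≤-trans (exit≤δ (v ∷ vs) h t u) (≤-reflexive (sym (exit-∉ t u h∉)))

  exits : ∀ (es : List (Edge n)) → Orientation es → List (Vertex n) → Vertex n → ℕ
  exits []       []      vs u = 0
  exits (x ∷ es) (p ∷ o) vs u = exit vs (hd p x) (tl p x) u + exits es o vs u

  indeg+exits≤degree : ∀ {es : List (Edge n)} → NoLoops es → ∀ o vs u → indeg es o u + exits es o vs u ≤ degree es u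
  indeg+exits≤degree [] [] vs u = z≤n
  indeg+exits≤degree {(a , b) ∷ es} (a≢b ∷ nl) (p ∷ o) vs u = begin
    δ h u + indeg es o u + (exit vs h t u + exits es o vs u)
      ≤⟨ +-monoʳ-≤ (δ h u + indeg es o u) (+-monoˡ-≤ (exits es o vs u) (exit≤δ vs h t u)) ⟩
    δ h u + indeg es o u + (δ t u + exits es o vs u)
      ≡⟨ interchange (δ h u) _ (δ t u) _ ⟩
    δ h u + δ t u + (indeg es o u + exits es o vs u)
      ≤⟨ +-mono-≤ (≤-reflexive (δ-hd-tl p a b u)) (indeg+exits≤degree nl o vs u) ⟩
    δ a u + δ b u + degree es u
      ≡⟨ sym (degree-∷ a b es u a≢b) ⟩
    degree ((a , b) ∷ es) u ∎
    where
    open ≤-Reasoning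
    h = hd p (a , b)
    t = tl p (a , b)

  bit : Bool → ℕ
  bit true  = 1
  bit false = 0

  -- The bookkeeping for one edge between v and w, directed from t to h, when v leaves the list. The
  -- edge either carries a grain or counts as an exit from v; and a grain reaching a processed u is
  -- covered by the edge from u to v, which becomes an exit at this moment.
  Selection : Vertex n → List (Vertex n) → (w h t : Vertex n) → Bool → Set
  Selection v vs w h t p = 1 ≤ bit p + exit vs h t v ×
    (∀ u → u ∉ v ∷ vs → (if p then δ w u else 0) + exit (v ∷ vs) h t u ≤ exit vs h t u)

  select-in : ∀ v vs w → v ∉ vs → ∃[ p ] Selection v vs w v w p
  select-in v vs w v∉ = true , s≤s z≤n , λ u u∉ → begin
    δ w u + exit (v ∷ vs) v w u ≡⟨ cong (δ w u +_) (exit-∈ {v ∷ vs} {v} w u (here refl)) ⟩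
    δ w u + 0                   ≡⟨ +-identityʳ _ ⟩
    δ w u                       ≡⟨ sym (exit-∉ w u v∉) ⟩
    exit vs v w u               ∎
    where open ≤-Reasoning

  -- An edge to a pending w may carry a grain, since it does not reach any processed vertex; if w is
  -- not pending, the edge is an exit and carries none.
  select-out : ∀ v vs w → ∃[ p ] Selection v vs w w v p
  select-out v vs w = go (w ∈? vs)
    where
    go : Dec (w ∈ vs) → ∃[ p ] Selection v vs w w v p
    go (yes w∈) = true , s≤s z≤n , λ u u∉ → ≤-trans
      (≤-reflexive (cong₂ _+_ (δ-≢ {u = w} {u} λ { refl → u∉ (there w∈) }) (exit-∈ {v ∷ vs} {w} v u (there w∈)))) z≤n
    go (no w∉)  = false , ≤-reflexive (sym (trans (exit-∉ v v w∉) (δ-refl v))) , λ u u∉ → exit-anti v vs w v u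

  Selects : Vertex n → List (Vertex n) → (ws : List (Vertex n)) → Vec Bool (length ws) → (List (Vertex n) → Vertex n → ℕ) → Set
  Selects v vs ws c E = length ws ≤ count c + E vs v × (∀ u → u ∉ v ∷ vs → received ws c u + E (v ∷ vs) u ≤ E vs u)

  selects-∷ : ∀ {v vs ws c E} w h t q → Selection v vs w h t q → Selects v vs ws c E →
              Selects v vs (w ∷ ws) (q ∷ c) (λ vs u → exit vs h t u + E vs u)
  selects-∷ {v} {vs} {ws} {c} {E} w h t q (k , g) (ks , gs) =
      ≤-trans (+-mono-≤ k ks) (≤-reflexive (trans (interchange (bit q) _ (count c) _) (cong (_+ (exit vs h t v + E vs v)) (sym (count-∷ q)))))
    , λ u u∉ → ≤-trans (≤-reflexive (trans (cong (_+ (exit (v ∷ vs) h t u + E (v ∷ vs) u)) (received-∷ q u)) (interchange (if q then δ w u else 0) _ _ _)))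
        (+-mono-≤ (g u u∉) (gs u u∉))
    where
    count-∷ : ∀ q → count (q ∷ c) ≡ bit q + count c
    count-∷ true  = refl
    count-∷ false = refl

    received-∷ : ∀ q t → received (w ∷ ws) (q ∷ c) t ≡ (if q then δ w t else 0) + received ws c t
    received-∷ true  t = refl
    received-∷ false t = refl

  selects-skip : ∀ {v vs ws c E} h t → Selects v vs ws c E → Selects v vs ws c (λ vs u → exit vs h t u + E vs u)
  selects-skip {v} {vs} {ws} {c} {E} h t (ks , gs) =
      ≤-trans ks (+-monoʳ-≤ (count c) (m≤n+m _ _))
    , λ u u∉ → ≤-trans (≤-reflexive (left-comm (received ws c u) (exit (v ∷ vs) h t u) _)) (+-mono-≤ (exit-anti v vs h t u) (gs u u∉))

  -- All edges at v carry a grain except those directed from v out of vs.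
  select : ∀ (es : List (Edge n)) o v vs → v ∉ vs → ∃[ c ] Selects v vs (nbrs es v) c (exits es o)
  select [] [] v vs v∉ = [] , z≤n , λ _ _ → z≤n
  select ((a , b) ∷ es) (p ∷ o) v vs v∉ with select es o v vs v∉ | a ≟ v | b ≟ v
  ... | c , s | yes refl | _ = proj₁ (first p) ∷ c , selects-∷ {E = exits es o} b (hd p (a , b)) (tl p (a , b)) (proj₁ (first p)) (proj₂ (first p)) s
    where
    first : ∀ p → ∃[ q ] Selection v vs b (hd p (a , b)) (tl p (a , b)) q
    first true  = select-out v vs b
    first false = select-in v vs b v∉
  ... | c , s | no _ | yes refl = proj₁ (second p) ∷ c , selects-∷ {E = exits es o} a (hd p (a , b)) (tl p (a , b)) (proj₁ (second p)) (proj₂ (second p)) s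
    where
    second : ∀ p → ∃[ q ] Selection v vs a (hd p (a , b)) (tl p (a , b)) q
    second true  = select-in v vs a v∉
    second false = select-out v vs a
  ... | c , s | no _ | no _ = c , selects-skip {ws = nbrs es v} {c} {exits es o} (hd p (a , b)) (tl p (a , b)) s

received-absent : ∀ {n} (vs : List (Vertex n)) c t → t ∉ vs → received vs c t ≡ 0
received-absent []       []          t t∉ = refl
received-absent (v ∷ vs) (true  ∷ c) t t∉ = cong₂ _+_ (δ-≢ {u = v} {t} λ { refl → t∉ (here refl) }) (received-absent vs c t (t∉ ∘ there))
received-absent (v ∷ vs) (false ∷ c) t t∉ = received-absent vs c t (t∉ ∘ there)

self∉nbrs : ∀ {n} {es : List (Edge n)} v → NoLoops es → v ∉ nbrs es v
self∉nbrs v [] ()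
self∉nbrs {es = (a , b) ∷ es} v (a≢b ∷ nl) v∈ with a ≟ v | b ≟ v
self∉nbrs v (a≢b ∷ nl) (here refl) | yes refl | _ = a≢b refl
self∉nbrs v (a≢b ∷ nl) (there v∈)  | yes refl | _ = self∉nbrs v nl v∈
self∉nbrs v (a≢b ∷ nl) (here refl) | no a≢v | yes refl = a≢v refl
self∉nbrs v (a≢b ∷ nl) (there v∈)  | no a≢v | yes refl = self∉nbrs v nl v∈
self∉nbrs v (a≢b ∷ nl) v∈ | no _ | no _ = self∉nbrs v nl v∈

module _ {n} (G : Graph n) (nl : NoLoops (edges G)) (o : Orientation (edges G))
         (o-positive : ∀ i → 0 < indeg (edges G) o (suc i)) where

  open DecMembership (_≟_ {suc n}) using (_∈?_)

  private
    es = edges G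

  -- The state of the chain when the vertices of vs still await their toppling.
  record Awaiting (vs : List (Vertex n)) (ζ : Config n) : Set where
    field
      full : ∀ i → suc i ∈ vs → Vec.lookup ζ i ≡ deg G (suc i)
      low  : ∀ i → suc i ∉ vs → Vec.lookup ζ i ≤ suc (exits es o vs (suc i))
  open Awaiting

  -- The extra one in `low` stems from the grain added to start a toppling; an incoming edge of `o`,
  -- which is never an exit of the same vertex, makes room for it.
  awaiting-stable : ∀ {vs ζ} → Awaiting vs ζ → Stable G ζ
  awaiting-stable {vs} aw i with suc i ∈? vs
  ... | yes i∈ = ≤-reflexive (full aw i i∈)
  ... | no i∉  = ≤-trans (low aw i i∉) (≤-trans (+-monoˡ-≤ (exits es o vs (suc i)) (o-positive i)) (indeg+exits≤degree nl o vs (suc i)))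

  -- The vertex j is full, so one added grain lets it topple. What lands on pending vertices is
  -- surplus, and `clear` carries it to the sink without touching the processed vertices.
  process : ∀ {j vs u ζ} → suc j ∉ vs → u ∈ vs → Adj G (suc j) u → Ordering G vs → Awaiting (suc j ∷ vs) ζ →
            ∃[ ζ′ ] Transition G ζ ζ′ × Awaiting vs ζ′
  process {j} {vs} {u} {ζ} j∉ u∈ a ord aw
    with c , kept , got ← select es o (suc j) vs j∉ = finish (clear G ord ζ₂ full₂)
    where
    ζ₁ = addGrain ζ j
    ζ₂ = topple G ζ₁ j c

    at-j : Vec.lookup ζ₁ j ≡ suc (deg G (suc j))
    at-j = trans (lookup∘updateAt j ζ) (cong suc (full aw j (here refl)))

    off-j : ∀ {i} → i ≢ j → Vec.lookup ζ₂ i ≡ Vec.lookup ζ i + received (nbrs es (suc j)) c (suc i)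
    off-j {i} i≢j = trans (topple-other G ζ₁ j c i≢j) (cong (_+ received (nbrs es (suc j)) c (suc i)) (lookup∘updateAt′ i j i≢j ζ))

    full₂ : ∀ i → suc i ∈ vs → deg G (suc i) ≤ Vec.lookup ζ₂ i
    full₂ i i∈ = ≤-trans (≤-reflexive (sym (full aw i (there i∈)))) (≤-trans (m≤m+n _ _) (≤-reflexive (sym (off-j λ { refl → j∉ i∈ }))))

    low₂ : ∀ i → suc i ∉ vs → Vec.lookup ζ₂ i ≤ suc (exits es o vs (suc i))
    low₂ i i∉ with i ≟ j
    ... | yes refl = begin
      Vec.lookup ζ₂ j                             ≡⟨ topple-self G ζ₁ j c ⟩
      Vec.lookup ζ₁ j ∸ count c + received (nbrs es (suc j)) c (suc j)
        ≡⟨ cong₂ (λ k r → k ∸ count c + r) at-j (received-absent (nbrs es (suc j)) c (suc j) (self∉nbrs (suc j) nl)) ⟩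
      suc (deg G (suc j)) ∸ count c + 0           ≡⟨ +-identityʳ _ ⟩
      -- Every edge at j carried a grain or counts as an exit, so the exits and the one added grain
      -- bound what remains.
      suc (deg G (suc j)) ∸ count c               ≤⟨ m≤n+o⇒m∸n≤o _ (count c) (≤-trans (s≤s kept) (≤-reflexive (sym (+-suc (count c) _)))) ⟩
      suc (exits es o vs (suc j))                 ∎
      where open ≤-Reasoning
    ... | no i≢j = begin
      Vec.lookup ζ₂ i                             ≡⟨ off-j i≢j ⟩
      Vec.lookup ζ i + received (nbrs es (suc j)) c (suc i)
        ≤⟨ +-monoˡ-≤ _ (low aw i i∉′) ⟩
      suc (exits es o (suc j ∷ vs) (suc i) + received (nbrs es (suc j)) c (suc i))
        ≡⟨ cong suc (+-comm (exits es o (suc j ∷ vs) (suc i)) _) ⟩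
      suc (received (nbrs es (suc j)) c (suc i) + exits es o (suc j ∷ vs) (suc i))
        ≤⟨ s≤s (got (suc i) i∉′) ⟩
      suc (exits es o vs (suc i))                 ∎
      where
      open ≤-Reasoning
      i∉′ : suc i ∉ suc j ∷ vs
      i∉′ (here refl) = i≢j refl
      i∉′ (there i∈)  = i∉ i∈

    finish : ∃[ ζ₃ ] Star (ToppleStep G) ζ₂ ζ₃ × (∀ i → suc i ∈ vs → Vec.lookup ζ₃ i ≡ deg G (suc i)) ×
             (∀ i → suc i ∉ vs → Vec.lookup ζ₃ i ≡ Vec.lookup ζ₂ i) →
             ∃[ ζ′ ] Transition G ζ ζ′ × Awaiting vs ζ′
    finish (ζ₃ , ss , full₃ , same) =
      ζ₃ , (awaiting-stable aw , j , step j (≤-reflexive (sym at-j)) c ◅ ss , awaiting-stable aw₃) , aw₃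
      where
      aw₃ : Awaiting vs ζ₃
      aw₃ = record { full = full₃ ; low = λ i i∉ → ≤-trans (≤-reflexive (same i i∉)) (low₂ i i∉) }

  process-all : ∀ {vs ζ} → Ordering G vs → Awaiting vs ζ → ∃[ ζ′ ] Star (Transition G) ζ ζ′ × Awaiting (sink ∷ []) ζ′
  process-all {ζ = ζ} base aw = ζ , ε , aw
  process-all (grow j∉ u∈ a ord) aw
    with ζ₁ , t , aw₁ ← process j∉ u∈ a ord aw
    with ζ₂ , ts , aw₂ ← process-all ord aw₁ = ζ₂ , t ◅ ts , aw₂

  reach : Connected G → ∀ {η} → Stable G η → (∀ i → deg G (suc i) < indeg es o (suc i) + Vec.lookup η i) →
          Star (Transition G) (maxConfig G) η
  reach conn {η} st d<
    with vs , ord , all ← connected-ordering conn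
    with ζ , ts , aw ← process-all ord (record
      { full = λ i _ → lookup∘tabulate (λ i → deg G (suc i)) i
      ; low  = λ i i∉ → contradiction (all (suc i)) i∉ })
    = ts ◅◅ raise G below st
    where
    below : ∀ i → Vec.lookup ζ i ≤ Vec.lookup η i
    -- With only the sink listed, ζ has at most one grain more than the exits, and indegree plus
    -- exits is at most the degree.
    below i = ≤-trans (low aw i λ { (here ()) ; (there ()) }) (+-cancelˡ-≤ (indeg es o (suc i)) _ _ (begin
      indeg es o (suc i) + suc (exits es o (sink ∷ []) (suc i)) ≡⟨ +-suc (indeg es o (suc i)) _ ⟩
      suc (indeg es o (suc i) + exits es o (sink ∷ []) (suc i)) ≤⟨ s≤s (indeg+exits≤degree nl o (sink ∷ []) (suc i)) ⟩
      suc (deg G (suc i))                                       ≤⟨ d< i ⟩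
      indeg es o (suc i) + Vec.lookup η i                       ∎))
      where open ≤-Reasoning

module _ {n} (G : Graph n) (conn : Connected G) where

  sto⇒oriented : ∀ {η} → Sto G η → Stable G η × Oriented G η
  sto⇒oriented (ts , _) = reachable-oriented G ts (maxConfig-stable G , maxConfig-oriented G conn)

  oriented⇒sto : NoLoops (edges G) → ∀ {η} → Stable G η → Oriented G η → Sto G η
  oriented⇒sto nl {η} st (o , d<) = reach G nl o positive conn st d< ,
    raise G (λ i → ≤-trans (st i) (≤-reflexive (sym (lookup∘tabulate (λ i → deg G (suc i)) i)))) (maxConfig-stable G)
    where
    positive : ∀ i → 0 < indeg (edges G) o (suc i)
    positive i = +-cancelʳ-< (Vec.lookup η i) _ _ (≤-<-trans (st i) (d< i))

-- Deletion and contraction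

noLoops : ∀ {n} {G : Graph n} → LoopFree G → NoLoops (edges G)
noLoops lf = All.tabulate lf

removeAt-⊆ : ∀ {A : Set} (xs : List A) i {x} → x ∈ removeAt xs i → x ∈ xs
removeAt-⊆ (x ∷ xs) zero    x∈         = there x∈
removeAt-⊆ (x ∷ xs) (suc i) (here eq)  = here eq
removeAt-⊆ (x ∷ xs) (suc i) (there x∈) = there (removeAt-⊆ xs i x∈)

lookup-removeAt : ∀ {A : Set} (xs : List A) e i → lookup xs i ≡ lookup xs e ⊎ lookup xs i ∈ removeAt xs e
lookup-removeAt (x ∷ xs) zero    zero    = inj₁ refl
lookup-removeAt (x ∷ xs) zero    (suc i) = inj₂ (∈-lookup i)
lookup-removeAt (x ∷ xs) (suc e) zero    = inj₂ (here refl)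
lookup-removeAt (x ∷ xs) (suc e) (suc i) with lookup-removeAt xs e i
... | inj₁ eq = inj₁ eq
... | inj₂ x∈ = inj₂ (there x∈)

∈⇒adj : ∀ {n} {G : Graph n} {u v} → (u , v) ∈ edges G → Adj G u v
∈⇒adj x∈ = adj (index x∈) (inj₁ (sym (lookup-index x∈)))

sameEdge-complete : ∀ {n} {u w a b : Vertex n} → (u ≡ a × w ≡ b) ⊎ (u ≡ b × w ≡ a) → sameEdge (u , w) (a , b) ≡ true
sameEdge-complete {u = u} {w} {a} {b} same = go same (((u ≟ a) ×-dec (w ≟ b)) ⊎-dec ((u ≟ b) ×-dec (w ≟ a)))
  where
  go : ∀ {P : Set} → P → (d : Dec P) → isYes d ≡ true
  go p (yes _) = refl
  go p (no ¬p) = contradiction p ¬p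

module ContractedGraph {n} (y : Fin (suc n)) (z : Fin n) where

  open Contraction y z

  private
    a b : Vertex (suc n)
    a = suc x
    b = suc y
    M = merge a b

  merge-ends : ∀ {v} → v ≡ a ⊎ v ≡ b → M v ≡ suc z
  merge-ends (inj₁ refl) = merge-punchIn a y z
  merge-ends (inj₂ refl) = merge-b

  merge-injective : ∀ u w → u ≢ w → M u ≡ M w → (u ≡ a × w ≡ b) ⊎ (u ≡ b × w ≡ a)
  merge-injective zero    zero    u≢w eq = contradiction refl u≢w
  merge-injective zero    (suc j) u≢w eq with punchView y j
  ... | self    = contradiction (trans (sym (merge-sink a y)) (trans eq merge-b)) λ ()
  ... | other t = contradiction (trans (sym (merge-sink a y)) (trans eq (merge-punchIn a y t))) λ ()
  merge-injective (suc i) zero    u≢w eq with punchView y i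
  ... | self    = contradiction (trans (sym merge-b) (trans eq (merge-sink a y))) λ ()
  ... | other t = contradiction (trans (sym (merge-punchIn a y t)) (trans eq (merge-sink a y))) λ ()
  merge-injective (suc i) (suc j) u≢w eq with punchView y i | punchView y j
  ... | self    | self    = contradiction refl u≢w
  ... | self    | other t = inj₂ (refl , cong (suc ∘ punchIn y) (sym (suc-injective (trans (sym merge-b) (trans eq (merge-punchIn a y t))))))
  ... | other s | self    = inj₁ (cong (suc ∘ punchIn y) (suc-injective (trans (sym (merge-punchIn a y s)) (trans eq merge-b))) , refl)
  ... | other s | other t = contradiction (cong (suc ∘ punchIn y) (suc-injective (trans (sym (merge-punchIn a y s)) (trans eq (merge-punchIn a y t))))) u≢w

  -- Only x and y are identified, so relabelling could make a loop only of a copy of e, and such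
  -- copies become edges to the sink.
  contract-noLoops : ∀ {es} → NoLoops es → NoLoops (contract* es)
  contract-noLoops [] = []
  contract-noLoops {(u , w) ∷ es} (u≢w ∷ nl) with sameEdge (u , w) (a , b) in eq
  ... | true  = (λ q → contradiction (trans (sym (merge-punchIn a y z)) q) λ ()) ∷ contract-noLoops nl
  ... | false = (λ q → contradiction (trans (sym eq) (sameEdge-complete (merge-injective u w u≢w q))) λ ()) ∷ contract-noLoops nl

  module _ (es : List (Edge (suc n))) (e : Fin (length es)) (e≡ : lookup es e ≡ (a , b)) where

    private
      H = graph (contract* (removeAt es e))

    -- A copy of e joins two vertices that have become one, so this step of a path disappears.
    contract-edge-path : ∀ u w → (u , w) ∈ removeAt es e → M u ≡ M w ⊎ Adj H (M u) (M w)
    contract-edge-path u w x∈ with sameEdge (u , w) (a , b) in eq | ∈-map⁺ (contractEdge (a , b)) x∈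
    ... | true  | _  = inj₁ (trans (merge-ends (sameEdge-hd (u , w) (a , b) eq false)) (sym (merge-ends (sameEdge-hd (u , w) (a , b) eq true))))
    ... | false | y∈ = inj₂ (∈⇒adj y∈)

    contract-adj : ∀ u w → Adj (graph es) u w → M u ≡ M w ⊎ Adj H (M u) (M w)
    contract-adj u w (adj i eq) with lookup-removeAt es e i | eq
    ... | inj₁ same | inj₁ q with refl ← trans (sym q) (trans same e≡) = inj₁ (trans (merge-ends (inj₁ refl)) (sym merge-b))
    ... | inj₁ same | inj₂ q with refl ← trans (sym q) (trans same e≡) = inj₁ (trans merge-b (sym (merge-ends (inj₁ refl))))
    ... | inj₂ x∈ | inj₁ q = contract-edge-path u w (subst (_∈ removeAt es e) q x∈)
    ... | inj₂ x∈ | inj₂ q with contract-edge-path w u (subst (_∈ removeAt es e) q x∈)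
    ...   | inj₁ same = inj₁ (sym same)
    ...   | inj₂ a    = inj₂ (adj-sym a)

    contract-path : ∀ {u w} → Star (Adj (graph es)) u w → Star (Adj H) (M u) (M w)
    contract-path ε = ε
    contract-path {u} {w} (_◅_ {j = v} st p) with contract-adj u v st
    ... | inj₁ same = subst (λ t → Star (Adj H) t (M w)) (sym same) (contract-path p)
    ... | inj₂ a    = a ◅ contract-path p

    contract-connected : Connected (graph es) → Connected H
    contract-connected conn zero    = ε
    contract-connected conn (suc t) = subst₂ (Star (Adj H)) (merge-sink a y) (merge-punchIn a y t) (contract-path (conn (suc (punchIn y t))))

-- Bijections between coefficient sets

refinement-↔ : ∀ {A B : Set} {P : A → Set} {Q : B → Set} → DecidableEquality A → DecidableEquality B →
  (f : A → B) (g : B → A) → (∀ x → P x → Q (f x)) → (∀ y → Q y → P (g y)) →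
  (∀ x → P x → g (f x) ≡ x) → (∀ y → Q y → f (g y) ≡ y) → Refinement A P ↔ Refinement B Q
refinement-↔ {A} {B} {P} {Q} _≟A_ _≟B_ f g fP gQ gf fg = mk↔ₛ′
  (λ (x , p) → f x , Irrelevant.map (fP x) p)
  (λ (y , q) → g y , Irrelevant.map (gQ y) q)
  -- The proof `q` is irrelevant, so the equation that it yields has to be recomputed by deciding
  -- equality.
  (λ { (y , [ q ]) → ext (recompute (f (g y) ≟B y) (fg y q)) })
  (λ { (x , [ p ]) → ext (recompute (g (f x) ≟A x) (gf x p)) })
  where
  ext : ∀ {C : Set} {R : C → Set} {r s : Refinement C R} → value r ≡ value s → r ≡ s
  ext refl = refl

refinement-⊎ : ∀ {A B : Set} {P : A ⊎ B → Set} → Refinement (A ⊎ B) P ↔ (Refinement A (P ∘ inj₁) ⊎ Refinement B (P ∘ inj₂))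
refinement-⊎ = mk↔ₛ′
  (λ { (inj₁ a , p) → inj₁ (a , p) ; (inj₂ b , p) → inj₂ (b , p) })
  (λ { (inj₁ (a , p)) → inj₁ a , p ; (inj₂ (b , p)) → inj₂ b , p })
  (λ { (inj₁ _) → refl ; (inj₂ _) → refl })
  (λ { (inj₁ _ , _) → refl ; (inj₂ _ , _) → refl })

_≟ⱽ_ : ∀ {n} → DecidableEquality (Vec ℕ n)
_≟ⱽ_ = Vecₚ.≡-dec ℕₚ._≟_

LackVectors : ∀ {n} → List (Edge n) → ℕ → Set
LackVectors {n} es k = Refinement (Vec ℕ n) (λ ℓ → Feasible es ℓ × sumV ℓ ≡ k)

-- Used in both directions: it is an involution on the vectors bounded by the degrees.
complement : ∀ {n} → Graph n → Vec ℕ n → Vec ℕ n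
complement G v = Vec.tabulate (λ i → deg G (suc i) ∸ Vec.lookup v i)

module _ {n} (G : Graph n) where

  private
    es = edges G

    lookup-complement : ∀ v i → Vec.lookup (complement G v) i ≡ deg G (suc i) ∸ Vec.lookup v i
    lookup-complement v = lookup∘tabulate (λ i → deg G (suc i) ∸ Vec.lookup v i)

  complement-stable : ∀ v → Stable G (complement G v)
  complement-stable v i = ≤-trans (≤-reflexive (lookup-complement v i)) (m∸n≤m _ (Vec.lookup v i))

  complement-involutive : ∀ v → Stable G v → complement G (complement G v) ≡ v
  complement-involutive v st = lookup-ext λ i → trans (lookup-complement (complement G v) i)
    (trans (cong (deg G (suc i) ∸_) (lookup-complement v i)) (m∸[m∸n]≡n (st i)))

  feasible-stable : ∀ ℓ → Feasible es ℓ → Stable G ℓ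
  feasible-stable ℓ (o , ℓ<o) i = ≤-trans (<⇒≤ (ℓ<o i)) (indeg≤degree es o (suc i))

  complement-feasible : ∀ η → Stable G η → Oriented G η → Feasible es (complement G η)
  complement-feasible η st (o , d<) = o , λ i → ≤-trans (≤-reflexive (trans (cong suc (lookup-complement η i)) (sym (+-∸-assoc 1 (st i)))))
    (m≤n+o⇒m∸n≤o _ (Vec.lookup η i) (≤-trans (d< i) (≤-reflexive (+-comm (indeg es o (suc i)) _))))

  complement-oriented : ∀ ℓ → Feasible es ℓ → Oriented G (complement G ℓ)
  complement-oriented ℓ feas@(o , ℓ<o) = o , λ i → ≤-trans (s≤s (≤-reflexive (sym (m+[n∸m]≡n (feasible-stable ℓ feas i)))))
    (+-mono-≤ (ℓ<o i) (≤-reflexive (sym (lookup-complement ℓ i))))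

  stoLack↔ : Connected G → NoLoops es → ∀ k → StoLack G k ↔ LackVectors es k
  stoLack↔ conn nl k = refinement-↔ _≟ⱽ_ _≟ⱽ_ (complement G) (complement G)
    -- `lack G η` unfolds to the sum of `complement G η`, so `sum≡` is passed on unchanged.
    (λ η (sto , sum≡) → let st , or = sto⇒oriented G conn sto in complement-feasible η st or , sum≡)
    (λ ℓ (feas , sum≡) → oriented⇒sto G conn nl (complement-stable ℓ) (complement-oriented ℓ feas) ,
      trans (cong sumV (complement-involutive ℓ (feasible-stable ℓ feas))) sum≡)
    (λ η (sto , _) → complement-involutive η (proj₁ (sto⇒oriented G conn sto)))
    (λ ℓ (feas , _) → complement-involutive ℓ (feasible-stable ℓ feas))

  -- Recording the factor x as `suc (sumV ℓ)` lets the deletion side share the exponent k; for k = 0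
  -- both sides are empty.
  xStoLack↔ : Connected G → NoLoops es → ∀ k → xStoLack G k ↔ Refinement (Vec ℕ n) (λ ℓ → Feasible es ℓ × suc (sumV ℓ) ≡ k)
  xStoLack↔ conn nl zero = mk↔ₛ′ (λ ()) (λ { (_ , [ p ]) → ⊥-elim-irr (absurd p) }) (λ { (_ , [ p ]) → ⊥-elim-irr (absurd p) }) (λ ())
    where
    absurd : ∀ {A : Set} {m} → A × suc m ≡ 0 → ⊥
    absurd ()
  xStoLack↔ conn nl (suc k) = ↔-trans (stoLack↔ conn nl k) (refinement-↔ _≟ⱽ_ _≟ⱽ_ (λ ℓ → ℓ) (λ ℓ → ℓ)
    (λ ℓ (feas , sum≡) → feas , cong suc sum≡) (λ ℓ (feas , sum≡) → feas , ℕₚ.suc-injective sum≡) (λ _ _ → refl) (λ _ _ → refl))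

deletion-contraction : ∀ {n} (G : Graph (suc n)) → Connected G → NoLoops (edges G) → ∀ e {y z} →
  lookup (edges G) e ≡ (suc (punchIn y z) , suc y) → Connected (delete G e) →
  ∀ k → StoLack G k ↔ (xStoLack (delete G e) k ⊎ StoLack (contract G e) k)
deletion-contraction G conn nl e {y} {z} e≡ conn⁻ k =
  -- `contract G e` reduces only after the chosen edge is inspected, so the result is transported
  -- from the explicit edge list.
  subst (λ H → StoLack G k ↔ (xStoLack (delete G e) k ⊎ StoLack H k)) (sym contract≡)
    (↔-trans (stoLack↔ G conn nl k)
    (↔-trans (refinement-↔ {P = Source es e e≡ k} {Target es e e≡ k} _≟ⱽ_ (Sumₚ.≡-dec _≟ⱽ_ _≟ⱽ_) (forward es e e≡) (backward es e e≡)
       (forward-target es e e≡) (backward-source es e e≡)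
       (λ ℓ (feas , _) → backward-forward es e e≡ ℓ feas) (forward-backward es e e≡))
    (↔-trans refinement-⊎
      (↔-sym (xStoLack↔ (delete G e) conn⁻ nl⁻ k) ⊎-↔
       ↔-sym (stoLack↔ (graph (contract* (removeAt es e))) (contract-connected es e e≡ conn) (contract-noLoops nl⁻) k)))))
  where
  open Contraction y z
  open ContractedGraph y z
  es = edges G

  nl⁻ : NoLoops (removeAt es e)
  nl⁻ = All.tabulate λ x∈ → All.lookup nl (removeAt-⊆ es e x∈)

  contract≡ : contract G e ≡ graph (contract* (removeAt es e))
  contract≡ = cong graph (trans (contract-edges G e) (cong (λ q → map (contractEdge q) (removeAt es e)) e≡))

theorem3p9 : ∀ {n} (G : Graph (suc n)) → Connected G → LoopFree G →
    (e : Fin (length (edges G))) →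
    (∀ {a b} → lookup (edges G) e ≡ (a , b) → a ≢ sink × b ≢ sink) →
    Connected (delete G e) →
    (k : ℕ) → StoLack G k ↔ (xStoLack (delete G e) k ⊎ StoLack (contract G e) k)
theorem3p9 {n} G conn loopFree e e≢s conn⁻ k = go (lookup (edges G) e) refl
  where
  go : ∀ x → lookup (edges G) e ≡ x → StoLack G k ↔ (xStoLack (delete G e) k ⊎ StoLack (contract G e) k)
  go (zero  , _)     e≡ = contradiction refl (proj₁ (e≢s e≡))
  go (suc _ , zero)  e≡ = contradiction refl (proj₂ (e≢s e≡))
  go (suc i , suc y) e≡ with punchView y i
  ... | self    = contradiction refl (loopFree (subst (_∈ edges G) e≡ (∈-lookup e)))
  ... | other z = deletion-contraction G conn (noLoops {G = G} loopFree) e e≡ conn⁻ k
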